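{- Let $\Pi_q$ be an arbitrary finite projective plane of order $q\ge 2$ (not necessarily Desarguesian). Then the minimum size of a saturating set $S$ in $\Pi_q$ satisfies $$\min |S| \le \left\lceil\sqrt{3q\ln q}\right\rceil+\left\lceil\frac{\sqrt{q}+1}{2}\right\rceil .$$
   Context: A projective plane of order $q$ has $q^2+q+1$ points and $q^2+q+1$ lines, with $q+1$ points on every line and $q+1$ lines through every point. A set $S$ of points of $\Pi_q$ is called saturating if every point of $\Pi_q$ outside $S$ is collinear with two distinct points of $S$ (i.e. lies on a line containing two distinct points of $S$). -}

module Defs where

open import Data.Empty using (⊥; ⊥-elim)
open import Data.Fin using (Fin)
open import Data.Fin.Subset using (Subset; _∈_; _∉_; ∣_∣)
open import Data.Integer as ℤ using (ℤ; +_; -[1+_])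
import Data.Integer.Properties as ℤ
open import Data.Integer.Tactic.RingSolver using () renaming (solve-∀ to ℤ-solve-∀)
open import Data.Nat as ℕ using (ℕ; zero; suc)
import Data.Nat.Properties as ℕ
open import Data.Product using (∃; ∃₂; ∃!; ∃-syntax; _×_; _,_; proj₁; proj₂)
open import Data.Rational
  using (ℚ; 0ℚ; 1ℚ; ½; _/_; _+_; _*_; -_; _-_; _<_; _≤_; mkℚ; toℚᵘ; fromℚᵘ;
         *<*; *≤*; 1/_; positive; nonNegative; Positive; NonNegative)
open import Data.Rational.Literals using (fromℤ)
open import Data.Rational.Properties
import Data.Rational.Unnormalised as ℚᵘ
import Data.Rational.Unnormalised.Properties as ℚᵘ
open import Data.Rational.Solver using (module +-*-Solver)
open import Data.Sum using (_⊎_; inj₁; inj₂)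
open import Function.Definitions using (Injective)
open import Relation.Binary.Definitions using (tri<; tri≈; tri>)
open import Relation.Binary.PropositionalEquality
  using (_≡_; _≢_; refl; sym; trans; cong; cong₂; subst; subst₂)
open import Relation.Nullary using (¬_; yes; no)

open +-*-Solver using (solve; con; _:=_; _:+_; _:*_; _:-_; :-_)

record ProjectivePlane : Set where
  field
    #points #lines : ℕ

  Point : Set
  Point = Fin #points

  Line : Set
  Line = Fin #lines

  field
    pointsOn   : Line → Subset #points
    join       : ∀ {A B} → A ≢ B → ∃! _≡_ λ l → A ∈ pointsOn l × B ∈ pointsOn l
    meet       : ∀ {l m} → l ≢ m → ∃! _≡_ λ A → A ∈ pointsOn l × A ∈ pointsOn m
    quadrangle : ∃[ Q ] Injective {A = Fin 4} {B = Point} _≡_ _≡_ Q ×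
                   (∀ l {i j k} → i ≢ j → j ≢ k → i ≢ k →
                     ¬ (Q i ∈ pointsOn l × Q j ∈ pointsOn l × Q k ∈ pointsOn l))

module _ (Π : ProjectivePlane) where
  open ProjectivePlane Π

  HasOrder : ℕ → Set
  HasOrder q = ∀ l → ∣ pointsOn l ∣ ≡ suc q

  Saturating : Subset #points → Set
  Saturating S = ∀ P → P ∉ S →
    ∃₂ λ A B → A ∈ S × B ∈ S × A ≢ B ×
      ∃ λ l → P ∈ pointsOn l × A ∈ pointsOn l × B ∈ pointsOn l

  IsMinSaturatingSize : ℕ → Set
  IsMinSaturatingSize m =
    (∃[ S ] Saturating S × ∣ S ∣ ≡ m) × (∀ S → Saturating S → m ℕ.≤ ∣ S ∣)

-- Dedekind cuts: L x r means r < x, and U x r means x < r.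
record ℝ : Set₁ where
  field
    L U         : ℚ → Set
    L-inhabited : ∃ L
    U-inhabited : ∃ U
    L-down      : ∀ {r s} → r < s → L s → L r
    U-up        : ∀ {r s} → r < s → U r → U s
    L-open      : ∀ {r} → L r → ∃[ s ] r < s × L s
    U-open      : ∀ {r} → U r → ∃[ s ] s < r × U s
    disjoint    : ∀ {r} → L r → U r → ⊥
    located     : ∀ {r s} → r < s → L r ⊎ U s

open ℝ

IsCeiling : ℝ → ℤ → Set
IsCeiling x n = L x (fromℤ (n ℤ.- + 1)) × ¬ L x (fromℤ n)

L-≤ : ∀ x {r s} → r ≤ s → L x s → L x r
L-≤ x {r} {s} r≤s Ls with <-cmp r s
... | tri< r<s _ _  = L-down x r<s Ls
... | tri≈ _ refl _ = Ls
... | tri> _ _ s<r  = ⊥-elim (<-irrefl refl (<-≤-trans s<r r≤s))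

U-≤ : ∀ x {r s} → r ≤ s → U x r → U x s
U-≤ x {r} {s} r≤s Ur with <-cmp r s
... | tri< r<s _ _  = U-up x r<s Ur
... | tri≈ _ refl _ = Ur
... | tri> _ _ s<r  = ⊥-elim (<-irrefl refl (<-≤-trans s<r r≤s))

L<U : ∀ x {r s} → L x r → U x s → r < s
L<U x {r} {s} Lr Us with r <? s
... | yes r<s = r<s
... | no  r≮s = ⊥-elim (disjoint x (L-≤ x (≮⇒≥ r≮s) Lr) Us)

p<p+ε : ∀ p {ε} → 0ℚ < ε → p < p + ε
p<p+ε p {ε} 0<ε = subst (_< p + ε) (+-identityʳ p) (+-monoʳ-< p 0<ε)

p-1<p : ∀ p → p - 1ℚ < p
p-1<p p = subst (p - 1ℚ <_) (+-identityʳ p)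
            (+-monoʳ-< p (*<* ℤ.-<+))

0<q-p : ∀ {p q} → p < q → 0ℚ < q - p
0<q-p {p} {q} p<q =
  subst (_< q - p) (+-inverseʳ p) (+-monoˡ-< (- p) p<q)

p+[q-p]≡q : ∀ p q → p + (q - p) ≡ q
p+[q-p]≡q = solve 2 (λ p q → p :+ (q :- p) := q) refl

0<* : ∀ {p q} → 0ℚ < p → 0ℚ < q → 0ℚ < p * q
0<* {p} {q} 0<p 0<q =
  positive⁻¹ (p * q) {{pos*pos⇒pos p {{positive 0<p}} q {{positive 0<q}}}}

0≤p² : ∀ p → 0ℚ ≤ p * p
0≤p² p with ≤-total 0ℚ p
... | inj₁ 0≤p = subst (_≤ p * p) (*-zeroˡ p) (*-monoʳ-≤-nonNeg p {{nonNegative 0≤p}} 0≤p)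
... | inj₂ p≤0 = subst (_≤ p * p) (*-zeroˡ p) (*-monoʳ-≤-nonPos p {{Data.Rational.nonPositive p≤0}} p≤0)

*-mono-<-nonNeg : ∀ {p q} → 0ℚ ≤ p → p < q → p * p < q * q
*-mono-<-nonNeg {p} {q} 0≤p p<q = ≤-<-trans
  (*-monoˡ-≤-nonNeg p {{nonNegative 0≤p}} (<⇒≤ p<q))
  (*-monoˡ-<-pos q {{positive (≤-<-trans 0≤p p<q)}} p<q)

reciprocal : ∀ {p} → 0ℚ < p → ∃[ r ] 0ℚ < r × p * r ≡ 1ℚ
reciprocal {p} 0<p = r , positive⁻¹ r {{1/pos⇒pos p}} , *-inverseʳ p
  where
  instance
    _ = positive 0<p
    _ = pos⇒nonZero p
  r = 1/ p

half+half : ∀ p → ½ * p + ½ * p ≡ p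
half+half = solve 1 (λ p → con ½ :* p :+ con ½ :* p := p) refl

0<½* : ∀ {p} → 0ℚ < p → 0ℚ < ½ * p
0<½* = 0<* {½} (*<* (ℤ.+<+ (ℕ.s≤s ℕ.z≤n)))

fromℤ-suc : ∀ n → fromℤ (+ suc n) ≡ 1ℚ + fromℤ (+ n)
fromℤ-suc n = toℚᵘ-injective (ℚᵘ.≃-trans (ℚᵘ.*≡* (eq (+ n)))
                (ℚᵘ.≃-sym (toℚᵘ-homo-+ 1ℚ (fromℤ (+ n)))))
  where
  eq : ∀ i → (+ 1 ℤ.+ i) ℤ.* (+ 1 ℤ.* + 1) ≡ (+ 1 ℤ.* + 1 ℤ.+ i ℤ.* + 1) ℤ.* + 1
  eq = ℤ-solve-∀

p≤∣↥p∣ : ∀ p → ∃[ n ] p ≤ fromℤ (+ n)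
p≤∣↥p∣ (mkℚ (+ n) d _) = n , *≤* (subst₂ ℤ._≤_ (sym (ℤ.*-identityʳ (+ n))) (ℤ.pos-* n (suc d)) (ℤ.+≤+ (ℕ.m≤m*n n (suc d))))
p≤∣↥p∣ (mkℚ -[1+ n ] d _) = 0 , *≤* (subst₂ ℤ._≤_ (sym (ℤ.*-identityʳ -[1+ n ])) refl ℤ.-≤+)

archimedean : ∀ {ε} → 0ℚ < ε → ∀ p → ∃[ n ] p ≤ fromℤ (+ n) * ε
archimedean {ε} 0<ε p =
  let r , _ , εr≡1 = reciprocal 0<ε
      n , pr≤n     = p≤∣↥p∣ (p * r)
      eq           = trans (trans (*-assoc p r ε) (cong (p *_) (trans (*-comm r ε) εr≡1)))
                           (*-identityʳ p)
  in n , subst (_≤ fromℤ (+ n) * ε) eq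
           (*-monoʳ-≤-nonNeg ε {{nonNegative (<⇒≤ 0<ε)}} pr≤n)

approximate : ∀ x {δ} → 0ℚ < δ → ∃[ a ] L x a × U x (a + δ)
approximate x {δ} 0<δ =
  let l , Ll     = L-inhabited x
      u , Uu     = U-inhabited x
      n , u-l≤nε = archimedean 0<ε (u - l)
  in search n l Ll (U-≤ x (subst (_≤ l + fromℤ (+ n) * ε) (p+[q-p]≡q l u)
                             (+-monoʳ-≤ l u-l≤nε)) Uu)
  where
  ε = ½ * δ
  0<ε = 0<½* 0<δ

  search : ∀ n a → L x a → U x (a + fromℤ (+ n) * ε) → ∃[ b ] L x b × U x (b + δ)
  search zero a La Ua = ⊥-elim (disjoint x La
    (subst (U x) (trans (cong (_+_ a) (*-zeroˡ ε)) (+-identityʳ a)) Ua))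
  search (suc n) a La Ua with located x (p<p+ε (a + ε) 0<ε)
  ... | inj₁ La+ε = search n (a + ε) La+ε (subst (U x) eq Ua)
    where
    eq : a + fromℤ (+ suc n) * ε ≡ (a + ε) + fromℤ (+ n) * ε
    eq = trans (cong (λ k → a + k * ε) (fromℤ-suc n))
      (solve 3 (λ a k ε → a :+ (con 1ℚ :+ k) :* ε := (a :+ ε) :+ k :* ε) refl
        a (fromℤ (+ n)) ε)
  ... | inj₂ Ua+2ε = a , La , subst (U x)
          (trans (+-assoc a ε ε) (cong (_+_ a) (half+half δ))) Ua+2ε

-- The ceiling is not a computable function of a cut; constructively it exists only up to ¬¬.
ceiling-¬¬exists : ∀ x → ¬ ¬ ∃ (IsCeiling x)
ceiling-¬¬exists x none =
  let l , Ll  = L-inhabited x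
      u , Uu  = U-inhabited x
      k , -l≤ = p≤∣↥p∣ (- l)
      n , u≤n = p≤∣↥p∣ u
  in below (fromℤ-neg k (subst (- fromℤ (+ k) ≤_) (neg-involutive l) (neg-antimono-≤ -l≤)) Ll)
       (k ℕ.+ n)
       λ Ln → disjoint x Ln (U-≤ x (subst (λ z → u ≤ fromℤ z) (eq k n) u≤n) Uu)
  where
  neg-involutive : ∀ p → - (- p) ≡ p
  neg-involutive = solve 1 (λ p → :- (:- p) := p) refl
  fromℤ-neg : ∀ k {l} → - fromℤ (+ k) ≤ l → L x l → L x (fromℤ (ℤ.- (+ k)))
  fromℤ-neg zero    = L-≤ x
  fromℤ-neg (suc k) = L-≤ x
  eq : ∀ k n → + n ≡ ℤ.- (+ k) ℤ.+ + (k ℕ.+ n)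
  eq k n = trans (eq′ (+ k) (+ n)) (cong (ℤ._+_ (ℤ.- (+ k))) (sym (ℤ.pos-+ k n)))
    where
    eq′ : ∀ i j → j ≡ ℤ.- i ℤ.+ (i ℤ.+ j)
    eq′ = ℤ-solve-∀
  below : ∀ {z} → L x (fromℤ z) → ∀ j → ¬ ¬ L x (fromℤ (z ℤ.+ + j))
  below {z} Lz zero    ¬L = ¬L (subst (λ i → L x (fromℤ i)) (sym (ℤ.+-identityʳ z)) Lz)
  below {z} Lz (suc j) ¬L = below Lz j λ Lj →
    none (z ℤ.+ + suc j , subst (λ i → L x (fromℤ i)) (pred z (+ j)) Lj , ¬L)
    where
    pred : ∀ z j → z ℤ.+ j ≡ (z ℤ.+ (+ 1 ℤ.+ j)) ℤ.- + 1
    pred = ℤ-solve-∀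

fromℚ : ℚ → ℝ
fromℚ p = record
  { L = _< p
  ; U = p <_
  ; L-inhabited = p - 1ℚ , p-1<p p
  ; U-inhabited = p + 1ℚ , p<p+ε p (*<* (ℤ.+<+ (ℕ.s≤s ℕ.z≤n)))
  ; L-down = <-trans
  ; U-up = λ r<s p<r → <-trans p<r r<s
  ; L-open = <-dense
  ; U-open = λ p<r → let s , p<s , s<r = <-dense p<r in s , s<r , p<s
  ; disjoint = <-asym
  ; located = loc
  }
  where
  loc : ∀ {r s} → r < s → r < p ⊎ p < s
  loc {r} r<s with r <? p
  ... | yes r<p = inj₁ r<p
  ... | no  r≮p = inj₂ (≤-<-trans (≮⇒≥ r≮p) r<s)

fromℕ : ℕ → ℝ
fromℕ n = fromℚ (fromℤ (+ n))

infixl 6 _⊕_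
_⊕_ : ℝ → ℝ → ℝ
x ⊕ y = record
  { L = λ r → ∃₂ λ s t → L x s × L y t × r < s + t
  ; U = λ r → ∃₂ λ s t → U x s × U y t × s + t < r
  ; L-inhabited = let s , Ls = L-inhabited x ; t , Lt = L-inhabited y
                  in (s + t) - 1ℚ , s , t , Ls , Lt , p-1<p (s + t)
  ; U-inhabited = let s , Us = U-inhabited x ; t , Ut = U-inhabited y
                  in (s + t) + 1ℚ , s , t , Us , Ut , p<p+ε (s + t) (*<* (ℤ.+<+ (ℕ.s≤s ℕ.z≤n)))
  ; L-down = λ { r<r′ (s , t , Ls , Lt , r′<) → s , t , Ls , Lt , <-trans r<r′ r′< }
  ; U-up = λ { r<r′ (s , t , Us , Ut , <r) → s , t , Us , Ut , <-trans <r r<r′ }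
  ; L-open = λ { (s , t , Ls , Lt , r<) → let m , r<m , m< = <-dense r<
                                           in m , r<m , s , t , Ls , Lt , m< }
  ; U-open = λ { (s , t , Us , Ut , <r) → let m , <m , m<r = <-dense <r
                                           in m , m<r , s , t , Us , Ut , <m }
  ; disjoint = λ { (s , t , Ls , Lt , r<) (s′ , t′ , Us′ , Ut′ , <r) →
      <-asym (+-mono-< (L<U x Ls Us′) (L<U y Lt Ut′)) (<-trans <r r<) }
  ; located = loc
  }
  where
  loc : ∀ {r r′} → r < r′ →
    (∃₂ λ s t → L x s × L y t × r < s + t) ⊎ (∃₂ λ s t → U x s × U y t × s + t < r′)
  loc {r} {r′} r<r′ =
    let m , r<m , m<r′ = <-dense r<r′
        0<δ            = 0<½* (0<q-p r<m)
        s , Ls , Us    = approximate x 0<δ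
        t , Lt , Ut    = approximate y 0<δ
    in decide m m<r′ (½ * (m - r)) (half+half (m - r)) s Ls Us t Lt Ut
    where
    decide : ∀ m → m < r′ → ∀ δ → δ + δ ≡ m - r →
             ∀ s → L x s → U x (s + δ) → ∀ t → L y t → U y (t + δ) → _
    decide m m<r′ δ δ+δ≡ s Ls Us t Lt Ut with r <? s + t
    ... | yes r<s+t = inj₁ (s , t , Ls , Lt , r<s+t)
    ... | no  r≮s+t = inj₂ (s + δ , t + δ , Us , Ut , ≤-<-trans le m<r′)
      where
      eq : (s + δ) + (t + δ) ≡ (s + t) + (m - r)
      eq = trans (solve 3 (λ s t δ → (s :+ δ) :+ (t :+ δ) := (s :+ t) :+ (δ :+ δ)) refl s t δ)
             (cong (_+_ (s + t)) δ+δ≡)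
      le : (s + δ) + (t + δ) ≤ m
      le = subst₂ _≤_ (sym eq) (p+[q-p]≡q r m) (+-monoˡ-≤ (m - r) (≮⇒≥ r≮s+t))

infixl 7 _·_
_·_ : ℕ → ℝ → ℝ
zero  · x = fromℕ 0
suc n · x = x ⊕ n · x

infixl 7 _/2
_/2 : ℝ → ℝ
x /2 = record
  { L = λ r → L x (r + r)
  ; U = λ r → U x (r + r)
  ; L-inhabited = let s , Ls = L-inhabited x in ½ * s , subst (L x) (sym (half+half s)) Ls
  ; U-inhabited = let s , Us = U-inhabited x in ½ * s , subst (U x) (sym (half+half s)) Us
  ; L-down = λ r<s → L-down x (+-mono-< r<s r<s)
  ; U-up = λ r<s → U-up x (+-mono-< r<s r<s)
  ; L-open = λ {r} Lr → let t , r+r<t , Lt = L-open x Lr in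
      ½ * t
      , subst (_< ½ * t) (halve-double r) (*-monoʳ-<-pos ½ r+r<t)
      , subst (L x) (sym (half+half t)) Lt
  ; U-open = λ {r} Ur → let t , t<r+r , Ut = U-open x Ur in
      ½ * t
      , subst (½ * t <_) (halve-double r) (*-monoʳ-<-pos ½ t<r+r)
      , subst (U x) (sym (half+half t)) Ut
  ; disjoint = disjoint x
  ; located = λ r<s → located x (+-mono-< r<s r<s)
  }
  where
  halve-double : ∀ r → ½ * (r + r) ≡ r
  halve-double r = trans (*-distribˡ-+ ½ r r) (half+half r)

-- Total: the value at a negative real is 0.
√ : ℝ → ℝ
√ x = record
  { L = λ r → r < 0ℚ ⊎ L x (r * r)
  ; U = λ r → 0ℚ < r × U x (r * r)
  ; L-inhabited = - 1ℚ , inj₁ (*<* ℤ.-<+)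
  ; U-inhabited = inhabited
  ; L-down = down
  ; U-up = λ { r<s (0<r , Ur) → <-trans 0<r r<s , U-up x (*-mono-<-nonNeg (<⇒≤ 0<r) r<s) Ur }
  ; L-open = openL
  ; U-open = λ { (0<r , Ur) → openU 0<r Ur }
  ; disjoint = λ { (inj₁ r<0) (0<r , _) → <-asym r<0 0<r ; (inj₂ Lr) (_ , Ur) → disjoint x Lr Ur }
  ; located = loc
  }
  where
  inhabited : ∃[ r ] 0ℚ < r × U x (r * r)
  inhabited with u , Uu ← U-inhabited x with ≤-total u 1ℚ
  ... | inj₁ u≤1 = 1ℚ , *<* (ℤ.+<+ (ℕ.s≤s ℕ.z≤n)) , U-≤ x u≤1 Uu
  ... | inj₂ 1≤u = u , 0<u , U-≤ x u≤u² Uu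
    where
    0<u = <-≤-trans (*<* (ℤ.+<+ (ℕ.s≤s ℕ.z≤n))) 1≤u
    u≤u² = subst (_≤ u * u) (*-identityʳ u)
             (*-monoˡ-≤-nonNeg u {{nonNegative (<⇒≤ 0<u)}} 1≤u)

  down : ∀ {r s} → r < s → s < 0ℚ ⊎ L x (s * s) → r < 0ℚ ⊎ L x (r * r)
  down r<s (inj₁ s<0) = inj₁ (<-trans r<s s<0)
  down {r} r<s (inj₂ Ls) with r <? 0ℚ
  ... | yes r<0 = inj₁ r<0
  ... | no  r≮0 = inj₂ (L-down x (*-mono-<-nonNeg (≮⇒≥ r≮0) r<s) Ls)

  openL : ∀ {r} → r < 0ℚ ⊎ L x (r * r) → ∃[ s ] r < s × (s < 0ℚ ⊎ L x (s * s))
  openL (inj₁ r<0) = let s , r<s , s<0 = <-dense r<0 in s , r<s , inj₁ s<0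
  openL {r} (inj₂ Lr) with r <? 0ℚ
  ... | yes r<0 = let s , r<s , s<0 = <-dense r<0 in s , r<s , inj₁ s<0
  ... | no  r≮0
    with t , r²<t , Lt ← L-open x Lr
    with d ← t - r * r in d≡
    with 0<d ← subst (0ℚ <_) d≡ (0<q-p r²<t)
    with c ← r + r + 1ℚ in c≡
    with 0<c ← subst (0ℚ <_) c≡ (≤-<-trans (+-mono-≤ (≮⇒≥ r≮0) (≮⇒≥ r≮0))
                                   (p<p+ε (r + r) (*<* (ℤ.+<+ (ℕ.s≤s ℕ.z≤n)))))
    with w , 0<w , Dw≡1 ← reciprocal (subst (_< c + d) (+-identityʳ 0ℚ) (+-mono-< 0<c 0<d))
    = r + e , p<p+ε r 0<e , inj₂ (L-≤ x le Lt)
    where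
    e = d * w
    0<e = 0<* 0<d 0<w
    De≡d : (c + d) * e ≡ d
    De≡d = trans (solve 3 (λ D d w → D :* (d :* w) := d :* (D :* w)) refl (c + d) d w)
             (trans (cong (d *_) Dw≡1) (*-identityʳ d))
    e≤1 : e ≤ 1ℚ
    e≤1 = *-cancelˡ-≤-pos (c + d) {{positive (<-trans 0<d d<D)}}
            (subst₂ _≤_ (sym De≡d) (sym (*-identityʳ (c + d))) (<⇒≤ d<D))
      where
      d<D = subst (d <_) (+-comm d c) (p<p+ε d 0<c)
    ee≤e : e * e ≤ e
    ee≤e = subst (e * e ≤_) (*-identityʳ e) (*-monoˡ-≤-nonNeg e {{nonNegative (<⇒≤ 0<e)}} e≤1)
    ce≤d : c * e ≤ d
    ce≤d = subst (c * e ≤_) De≡d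
             (*-monoʳ-≤-nonNeg e {{nonNegative (<⇒≤ 0<e)}} (<⇒≤ (p<p+ε c 0<d)))
    open ≤-Reasoning
    le : (r + e) * (r + e) ≤ t
    le = begin
      (r + e) * (r + e)            ≡⟨ solve 2 (λ r e → (r :+ e) :* (r :+ e) := r :* r :+ (r :+ r) :* e :+ e :* e) refl r e ⟩
      r * r + (r + r) * e + e * e  ≤⟨ +-monoʳ-≤ (r * r + (r + r) * e) ee≤e ⟩
      r * r + (r + r) * e + e      ≡⟨ solve 2 (λ r e → r :* r :+ (r :+ r) :* e :+ e := r :* r :+ (r :+ r :+ con 1ℚ) :* e) refl r e ⟩
      r * r + (r + r + 1ℚ) * e     ≡⟨ cong (λ k → r * r + k * e) c≡ ⟩
      r * r + c * e                ≤⟨ +-monoʳ-≤ (r * r) ce≤d ⟩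
      r * r + d                    ≡⟨ cong (_+_ (r * r)) (sym d≡) ⟩
      r * r + (t - r * r)          ≡⟨ p+[q-p]≡q (r * r) t ⟩
      t                            ∎

  openU : ∀ {r} → 0ℚ < r → U x (r * r) → ∃[ s ] s < r × 0ℚ < s × U x (s * s)
  openU {r} 0<r Ur with t , t<r² , Ut ← U-open x Ur with 0ℚ <? t
  ... | no 0≮t = let s , 0<s , s<r = <-dense 0<r in
        s , s<r , 0<s , U-≤ x (≤-trans (≮⇒≥ 0≮t) (0≤p² s)) Ut
  ... | yes 0<t with w , 0<w , rw≡1 ← reciprocal 0<r =
        s , s<r , 0<s , U-≤ x le Ut
    where
    k = t * w
    s = ½ * (r + k)
    rk≡t : r * k ≡ t
    rk≡t = trans (solve 3 (λ r t w → r :* (t :* w) := t :* (r :* w)) refl r t w)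
             (trans (cong (t *_) rw≡1) (*-identityʳ t))
    k<r : k < r
    k<r = *-cancelˡ-<-nonNeg r {{nonNegative (<⇒≤ 0<r)}} (subst (_< r * r) (sym rk≡t) t<r²)
    s<r : s < r
    s<r = subst (s <_) (trans (*-distribˡ-+ ½ r r) (half+half r))
            (*-monoʳ-<-pos ½ (+-monoʳ-< r k<r))
    0<s : 0ℚ < s
    0<s = 0<½* (subst (_< r + k) (+-identityʳ 0ℚ) (+-mono-< 0<r (0<* 0<t 0<w)))
    open ≤-Reasoning
    le : t ≤ s * s
    le = begin
      t                  ≡⟨ +-identityʳ t ⟨
      t + 0ℚ             ≤⟨ +-monoʳ-≤ t (0≤p² (½ * (r - k))) ⟩
      t + ½ * (r - k) * (½ * (r - k))
                         ≡⟨ cong (_+ ½ * (r - k) * (½ * (r - k))) (sym rk≡t) ⟩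
      r * k + ½ * (r - k) * (½ * (r - k))
                         ≡⟨ solve 2 (λ r k → r :* k :+ con ½ :* (r :- k) :* (con ½ :* (r :- k))
                                       := con ½ :* (r :+ k) :* (con ½ :* (r :+ k))) refl r k ⟩
      s * s              ∎

  loc : ∀ {r s} → r < s → (r < 0ℚ ⊎ L x (r * r)) ⊎ (0ℚ < s × U x (s * s))
  loc {r} r<s with r <? 0ℚ
  ... | yes r<0 = inj₁ (inj₁ r<0)
  ... | no  r≮0 with located x (*-mono-<-nonNeg (≮⇒≥ r≮0) r<s)
  ...   | inj₁ Lr = inj₁ (inj₂ Lr)
  ...   | inj₂ Us = inj₂ (≤-<-trans (≮⇒≥ r≮0) r<s , Us)

sumBelow : ℕ → (ℕ → ℚ) → ℚ
sumBelow zero    f = 0ℚ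
sumBelow (suc N) f = sumBelow N f + f N

-- The Darboux sums of ∫₁^q dt/t for the partition of [1 , q] into intervals
-- of length 1/n, n = suc m: on [1 + i/n , 1 + (i+1)/n] the infimum of 1/t
-- contributes (1/n) · 1/(1 + (i+1)/n) = 1/(n + i + 1), the supremum 1/(n + i).
lowerSum : ℕ → ℕ → ℚ
lowerSum q m = sumBelow ((q ℕ.∸ 1) ℕ.* suc m) λ i → + 1 / (suc m ℕ.+ suc i)

upperSum : ℕ → ℕ → ℚ
upperSum q m = sumBelow ((q ℕ.∸ 1) ℕ.* suc m) λ i → + 1 / (suc m ℕ.+ i)

sum-mono : ∀ N {f g} → (∀ i → i ℕ.< N → f i ≤ g i) → sumBelow N f ≤ sumBelow N g
sum-mono zero    f≤g = ≤-refl
sum-mono (suc N) f≤g =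
  +-mono-≤ (sum-mono N λ i i<N → f≤g i (ℕ.m<n⇒m<1+n i<N)) (f≤g N ℕ.≤-refl)

sum-cong : ∀ N {f g} → (∀ i → f i ≡ g i) → sumBelow N f ≡ sumBelow N g
sum-cong zero    f≡g = refl
sum-cong (suc N) f≡g = cong₂ _+_ (sum-cong N f≡g) (f≡g N)

sum-const : ∀ N c → sumBelow N (λ _ → c) ≡ fromℤ (+ N) * c
sum-const zero    c = sym (*-zeroˡ c)
sum-const (suc N) c = trans (cong (_+ c) (sum-const N c))
  (trans (solve 2 (λ k c → k :* c :+ c := (con 1ℚ :+ k) :* c) refl (fromℤ (+ N)) c)
         (cong (_* c) (sym (fromℤ-suc N))))

sum-+ : ∀ M N f → sumBelow (M ℕ.+ N) f ≡ sumBelow M f + sumBelow N (λ j → f (M ℕ.+ j))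
sum-+ M zero    f rewrite ℕ.+-identityʳ M = sym (+-identityʳ (sumBelow M f))
sum-+ M (suc N) f rewrite ℕ.+-suc M N =
  trans (cong (_+ f (M ℕ.+ N)) (sum-+ M N f))
        (+-assoc (sumBelow M f) (sumBelow N (λ j → f (M ℕ.+ j))) (f (M ℕ.+ N)))

sum-* : ∀ M N f → sumBelow (M ℕ.* N) f ≡ sumBelow M λ i → sumBelow N λ j → f (i ℕ.* N ℕ.+ j)
sum-* zero    N f = refl
sum-* (suc M) N f = trans (cong (λ k → sumBelow k f) (ℕ.+-comm N (M ℕ.* N)))
  (trans (sum-+ (M ℕ.* N) N f)
         (cong (_+ sumBelow N (λ j → f (M ℕ.* N ℕ.+ j))) (sum-* M N f)))

1/-antimono : ∀ {m n} → m ℕ.≤ n → + 1 / suc n ≤ + 1 / suc m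
1/-antimono {m} {n} m≤n = toℚᵘ-cancel-≤ (begin
  toℚᵘ (+ 1 / suc n)       ≃⟨ toℚᵘ-fromℚᵘ (ℚᵘ.mkℚᵘ (+ 1) n) ⟩
  ℚᵘ.mkℚᵘ (+ 1) n          ≤⟨ ℚᵘ.*≤* (ℤ.*-monoˡ-≤-nonNeg (+ 1) (ℤ.+≤+ (ℕ.s≤s m≤n))) ⟩
  ℚᵘ.mkℚᵘ (+ 1) m          ≃⟨ toℚᵘ-fromℚᵘ (ℚᵘ.mkℚᵘ (+ 1) m) ⟨
  toℚᵘ (+ 1 / suc m)       ∎)
  where open ℚᵘ.≤-Reasoning

n*1/[n*k]≡1/k : ∀ n k → fromℤ (+ suc n) * (+ 1 / (suc n ℕ.* suc k)) ≡ + 1 / suc k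
n*1/[n*k]≡1/k n k = toℚᵘ-injective (begin-equality
  toℚᵘ (fromℤ (+ suc n) * (+ 1 / (suc n ℕ.* suc k)))
    ≃⟨ toℚᵘ-homo-* (fromℤ (+ suc n)) (+ 1 / (suc n ℕ.* suc k)) ⟩
  toℚᵘ (fromℤ (+ suc n)) ℚᵘ.* toℚᵘ (+ 1 / (suc n ℕ.* suc k))
    ≃⟨ ℚᵘ.*-congˡ {toℚᵘ (fromℤ (+ suc n))} (toℚᵘ-fromℚᵘ (ℚᵘ.mkℚᵘ (+ 1) (k ℕ.+ n ℕ.* suc k))) ⟩
  ℚᵘ.mkℚᵘ (+ suc n) 0 ℚᵘ.* ℚᵘ.mkℚᵘ (+ 1) (k ℕ.+ n ℕ.* suc k)
    ≃⟨ ℚᵘ.*≡* (trans (eq (+ suc n) (+ suc k))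
         (cong (λ z → + 1 ℤ.* (+ 1 ℤ.* z)) (sym (ℤ.pos-* (suc n) (suc k))))) ⟩
  ℚᵘ.mkℚᵘ (+ 1) k
    ≃⟨ toℚᵘ-fromℚᵘ (ℚᵘ.mkℚᵘ (+ 1) k) ⟨
  toℚᵘ (+ 1 / suc k) ∎)
  where
  open ℚᵘ.≤-Reasoning
  eq : ∀ i j → (i ℤ.* + 1) ℤ.* j ≡ + 1 ℤ.* (+ 1 ℤ.* (i ℤ.* j))
  eq = ℤ-solve-∀

1/n<ε : ∀ {ε} → 0ℚ < ε → ∃[ n ] + 1 / suc n < ε
1/n<ε {ε} 0<ε =
  let n , 1≤nε = archimedean 0<ε 1ℚ
      1<snε    = subst (1ℚ <_) (trans (eq (fromℤ (+ n)) ε) (cong (_* ε) (sym (fromℤ-suc n))))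
                   (≤-<-trans 1≤nε (p<p+ε (fromℤ (+ n) * ε) 0<ε))
  in n , *-cancelˡ-<-nonNeg (fromℤ (+ suc n)) (subst (_< fromℤ (+ suc n) * ε) (sym (n*1/n≡1 n)) 1<snε)
  where
  eq : ∀ k ε → k * ε + ε ≡ (1ℚ + k) * ε
  eq = solve 2 (λ k ε → k :* ε :+ ε := (con 1ℚ :+ k) :* ε) refl
  n*1/n≡1 : ∀ n → fromℤ (+ suc n) * (+ 1 / suc n) ≡ 1ℚ
  n*1/n≡1 n = trans (cong (fromℤ (+ suc n) *_) (/-cong {+ 1} {q₁ = suc n} {q₂ = suc n ℕ.* 1} refl (sym (ℕ.*-identityʳ (suc n)))))
                (n*1/[n*k]≡1/k n 0)

-- suc (refine m n) = suc m * suc n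
refine : ℕ → ℕ → ℕ
refine m n = n ℕ.+ m ℕ.* suc n

lowerSum-refine : ∀ q m n → lowerSum q m ≤ lowerSum q (refine m n)
lowerSum-refine q m n = begin
  sumBelow K (λ i → + 1 / (suc m ℕ.+ suc i))
    ≤⟨ sum-mono K (λ i _ → step i) ⟩
  sumBelow K (λ i → sumBelow (suc n) λ j → f (i ℕ.* suc n ℕ.+ j))
    ≡⟨ sum-* K (suc n) f ⟨
  sumBelow (K ℕ.* suc n) f
    ≡⟨ cong (λ k → sumBelow k f) (ℕ.*-assoc (q ℕ.∸ 1) (suc m) (suc n)) ⟩
  lowerSum q (refine m n) ∎
  where
  open ≤-Reasoning
  K = (q ℕ.∸ 1) ℕ.* suc m
  f : ℕ → ℚ
  f i = + 1 / (suc (refine m n) ℕ.+ suc i)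
  bound : ∀ i j → j ℕ.< suc n →
          refine m n ℕ.+ suc (i ℕ.* suc n ℕ.+ j) ℕ.≤ refine (m ℕ.+ suc i) n
  bound i j j<n = ℕ.≤-trans
    (ℕ.+-monoʳ-≤ (refine m n) (ℕ.≤-trans (ℕ.≤-reflexive (sym (ℕ.+-suc (i ℕ.* suc n) j)))
      (ℕ.≤-trans (ℕ.+-monoʳ-≤ (i ℕ.* suc n) j<n) (ℕ.≤-reflexive (ℕ.+-comm (i ℕ.* suc n) (suc n))))))
    (ℕ.≤-reflexive (trans (ℕ.+-assoc n (m ℕ.* suc n) (suc i ℕ.* suc n))
      (cong (n ℕ.+_) (sym (ℕ.*-distribʳ-+ (suc n) m (suc i))))))
  step : ∀ i → + 1 / (suc m ℕ.+ suc i) ≤ sumBelow (suc n) λ j → f (i ℕ.* suc n ℕ.+ j)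
  step i = begin
    + 1 / (suc m ℕ.+ suc i)
      ≡⟨ n*1/[n*k]≡1/k n (m ℕ.+ suc i) ⟨
    fromℤ (+ suc n) * (+ 1 / (suc n ℕ.* suc (m ℕ.+ suc i)))
      ≡⟨ sum-const (suc n) (+ 1 / (suc n ℕ.* suc (m ℕ.+ suc i))) ⟨
    sumBelow (suc n) (λ _ → + 1 / (suc n ℕ.* suc (m ℕ.+ suc i)))
      ≤⟨ sum-mono (suc n) (λ j j<n → subst (_≤ f (i ℕ.* suc n ℕ.+ j))
           (/-cong {+ 1} {q₁ = suc (m ℕ.+ suc i) ℕ.* suc n} {q₂ = suc n ℕ.* suc (m ℕ.+ suc i)} refl
             (ℕ.*-comm (suc (m ℕ.+ suc i)) (suc n)))
           (1/-antimono (bound i j j<n))) ⟩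
    sumBelow (suc n) (λ j → f (i ℕ.* suc n ℕ.+ j)) ∎

upperSum-refine : ∀ q m n → upperSum q (refine m n) ≤ upperSum q m
upperSum-refine q m n = begin
  upperSum q (refine m n)
    ≡⟨ cong (λ k → sumBelow k f) (ℕ.*-assoc (q ℕ.∸ 1) (suc m) (suc n)) ⟨
  sumBelow (K ℕ.* suc n) f
    ≡⟨ sum-* K (suc n) f ⟩
  sumBelow K (λ i → sumBelow (suc n) λ j → f (i ℕ.* suc n ℕ.+ j))
    ≤⟨ sum-mono K (λ i _ → step i) ⟩
  sumBelow K (λ i → + 1 / (suc m ℕ.+ i)) ∎
  where
  open ≤-Reasoning
  K = (q ℕ.∸ 1) ℕ.* suc m
  f : ℕ → ℚ
  f i = + 1 / (suc (refine m n) ℕ.+ i)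
  bound : ∀ i j → refine (m ℕ.+ i) n ℕ.≤ refine m n ℕ.+ (i ℕ.* suc n ℕ.+ j)
  bound i j = ℕ.≤-trans
    (ℕ.≤-reflexive (trans (cong (n ℕ.+_) (ℕ.*-distribʳ-+ (suc n) m i))
      (sym (ℕ.+-assoc n (m ℕ.* suc n) (i ℕ.* suc n)))))
    (ℕ.+-monoʳ-≤ (refine m n) (ℕ.m≤m+n (i ℕ.* suc n) j))
  step : ∀ i → sumBelow (suc n) (λ j → f (i ℕ.* suc n ℕ.+ j)) ≤ + 1 / (suc m ℕ.+ i)
  step i = begin
    sumBelow (suc n) (λ j → f (i ℕ.* suc n ℕ.+ j))
      ≤⟨ sum-mono (suc n) (λ j _ → subst (f (i ℕ.* suc n ℕ.+ j) ≤_)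
           (/-cong {+ 1} {q₁ = suc (m ℕ.+ i) ℕ.* suc n} {q₂ = suc n ℕ.* suc (m ℕ.+ i)} refl
             (ℕ.*-comm (suc (m ℕ.+ i)) (suc n)))
           (1/-antimono (bound i j))) ⟩
    sumBelow (suc n) (λ _ → + 1 / (suc n ℕ.* suc (m ℕ.+ i)))
      ≡⟨ sum-const (suc n) (+ 1 / (suc n ℕ.* suc (m ℕ.+ i))) ⟩
    fromℤ (+ suc n) * (+ 1 / (suc n ℕ.* suc (m ℕ.+ i)))
      ≡⟨ n*1/[n*k]≡1/k n (m ℕ.+ i) ⟩
    + 1 / (suc m ℕ.+ i) ∎

lowerSum≤upperSum : ∀ q m n → lowerSum q m ≤ upperSum q n
lowerSum≤upperSum q m n = begin
  lowerSum q m             ≤⟨ lowerSum-refine q m n ⟩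
  lowerSum q (refine m n)  ≤⟨ sum-mono ((q ℕ.∸ 1) ℕ.* suc (refine m n))
                                (λ i _ → 1/-antimono (ℕ.+-monoʳ-≤ (refine m n) (ℕ.n≤1+n i))) ⟩
  upperSum q (refine m n)  ≡⟨ cong (upperSum q) (ℕ.suc-injective (ℕ.*-comm (suc m) (suc n))) ⟩
  upperSum q (refine n m)  ≤⟨ upperSum-refine q n m ⟩
  upperSum q n             ∎
  where open ≤-Reasoning

upperSum≤lowerSum+1/n : ∀ q m → upperSum q m ≤ lowerSum q m + + 1 / suc m
upperSum≤lowerSum+1/n q m = subst (upperSum q m ≤_) (telescope K)
  (subst (_≤ upperSum q m + u (m ℕ.+ K)) (+-identityʳ (upperSum q m))
    (+-monoʳ-≤ (upperSum q m)
      (<⇒≤ (positive⁻¹ (u (m ℕ.+ K)) {{normalize-pos 1 (suc (m ℕ.+ K))}}))))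
  where
  K = (q ℕ.∸ 1) ℕ.* suc m
  u : ℕ → ℚ
  u k = + 1 / suc k
  telescope : ∀ N → sumBelow N (λ i → u (m ℕ.+ i)) + u (m ℕ.+ N) ≡
                    sumBelow N (λ i → u (m ℕ.+ suc i)) + u m
  telescope zero    = cong (λ k → 0ℚ + u k) (ℕ.+-identityʳ m)
  telescope (suc N) = trans (cong (_+ c) (telescope N))
    (trans (+-assoc b a c) (trans (cong (_+_ b) (+-comm a c)) (sym (+-assoc b c a))))
    where
    a = u m
    b = sumBelow N (λ i → u (m ℕ.+ suc i))
    c = u (m ℕ.+ suc N)

-- ln q = ∫₁^q dt/t, for q ≥ 1; ln 0 takes the junk value 0.
ln : ℕ → ℝ
ln q = record
  { L = λ r → ∃[ m ] r < lowerSum q m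
  ; U = λ r → ∃[ m ] upperSum q m < r
  ; L-inhabited = lowerSum q 0 - 1ℚ , 0 , p-1<p (lowerSum q 0)
  ; U-inhabited = upperSum q 0 + 1ℚ , 0 , p<p+ε (upperSum q 0) (*<* (ℤ.+<+ (ℕ.s≤s ℕ.z≤n)))
  ; L-down = λ { r<s (m , s<) → m , <-trans r<s s< }
  ; U-up = λ { r<s (m , <r) → m , <-trans <r r<s }
  ; L-open = λ { (m , r<) → let s , r<s , s< = <-dense r< in s , r<s , m , s< }
  ; U-open = λ { (m , <r) → let s , <s , s<r = <-dense <r in s , s<r , m , <s }
  ; disjoint = λ { (m , r<) (n , <r) →
      <-irrefl refl (<-trans r< (≤-<-trans (lowerSum≤upperSum q m n) <r)) }
  ; located = loc
  }
  where
  loc : ∀ {r s} → r < s → (∃[ m ] r < lowerSum q m) ⊎ (∃[ m ] upperSum q m < s)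
  loc {r} {s} r<s = decide (1/n<ε (0<q-p r<s))
    where
    decide : ∃[ n ] + 1 / suc n < s - r → _
    decide (n , 1/n<) with r <? lowerSum q n
    ... | yes r<l = inj₁ (n , r<l)
    ... | no  r≮l = inj₂ (n , subst (upperSum q n <_) (p+[q-p]≡q r s)
                      (≤-<-trans (≤-trans (upperSum≤lowerSum+1/n q n)
                                          (+-monoˡ-≤ (+ 1 / suc n) (≮⇒≥ r≮l)))
                                 (+-monoʳ-< r 1/n<)))

{-# OPTIONS --safe #-}

-- Build S greedily. A point P left uncovered by i points lies on i distinct lines to them, which
-- contain q i points besides P, and choosing any of these outside S covers P. Averaging over the
-- points outside S, some choice multiplies the number R of uncovered points by at most
-- q (q + 1 - i) / (q² + q + 1 - i). With k = ⌈√(3 q ln q)⌉ this gives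
-- R ≤ q² ∏ q (q - j) / (q² + q - j), 0 < j < k, after k + 1 points. By AM-GM the product of the
-- q - j is close to (q - k/2)^(k-1); the denominators make up for the k-th factor, so that
-- R < q² (1 - k/2q)^k ≤ √q, as q³ ≤ (1 - k/2q)^-2k. Finally any two uncovered points are covered
-- by a single point: the intersection of lines joining them to two different points of S.
-- As R < √q ≤ 2 ⌈(√q + 1)/2⌉ - 1, another ⌈(√q + 1)/2⌉ - 1 points suffice.
-- If k > q, already q + 2 greedy points leave nothing uncovered.

module Submission where

open import Defs
open import Data.Integer using (ℤ; +_)
import Data.Integer as ℤ
open import Data.Nat using (ℕ; _≤_; _*_)
open import Data.Product using (∃-syntax; _×_)

open import Data.Bool using (if_then_else_)
open import Data.Fin using (Fin; zero; suc)
open import Data.Fin.Properties using (any?; all?) renaming (_≟_ to _≟ᶠ_)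
open import Data.Fin.Subset using (Subset; _∈_; _∉_; ∣_∣; inside; outside; ⊥)
open import Data.Fin.Subset.Properties using (_∈?_; ∣⊥∣≡0; anySubset?)
open import Data.Integer using (-[1+_])
import Data.Integer.Properties as ℤ
open import Data.Nat as ℕ
  using (zero; suc; pred; _+_; _∸_; _^_; _<_; z≤n; s≤s; z<s; _≤?_; _<?_; NonZero; ≢-nonZero⁻¹; >-nonZero)
open import Data.Nat.Properties as ℕ
open import Data.Nat.Tactic.RingSolver using (solve-∀)
open import Data.Product using (∃; ∃₂; ∃!; _,_; proj₁; proj₂)
open import Data.Rational as ℚ using (ℚ; 0ℚ; 1ℚ; ½; _/_; _-_; *<*; *≤*; positive; nonNegative)
open import Data.Rational.Literals using (fromℤ)
import Data.Rational.Properties as ℚ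
open import Data.Rational.Solver using (module +-*-Solver)
open import Data.Sum using (_⊎_; inj₁; inj₂)
open import Data.Empty using (⊥-elim)
open import Data.Vec using (_∷_; []; _[_]≔_; here; there)
open import Data.Vec.Functional using (Vector)
open import Data.Vec.Properties using ([]≔-updates; []≔-minimal)
open import Function using (_∘_)
open import Relation.Binary.PropositionalEquality
open import Relation.Nullary using (¬_; Dec; yes; no; does; contradiction)
open import Relation.Nullary.Decidable
  using (dec-true; dec-false; _×-dec_; _→-dec_; ¬?; decidable-stable; from-yes)
open import Relation.Unary using (Decidable)
open import Algebra.Properties.Semiring.Sum ℕ.+-*-semiring
  using (sum; sum-syntax; sum-cong-≗; ∑-distrib-+; ∑-comm; *-distribˡ-sum; *-distribʳ-sum)
open +-*-Solver using (solve; con; _:=_; _:+_; _:*_; _:-_)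

-- Bounds on the logarithm

⟪_⟫ : ℕ → ℚ
⟪ n ⟫ = fromℤ (+ n)

⟪⟫-+ : ∀ m n → ⟪ m + n ⟫ ≡ ⟪ m ⟫ ℚ.+ ⟪ n ⟫
⟪⟫-+ zero    n = sym (ℚ.+-identityˡ ⟪ n ⟫)
⟪⟫-+ (suc m) n = begin
  ⟪ suc (m + n) ⟫          ≡⟨ fromℤ-suc (m + n) ⟩
  1ℚ ℚ.+ ⟪ m + n ⟫         ≡⟨ cong (1ℚ ℚ.+_) (⟪⟫-+ m n) ⟩
  1ℚ ℚ.+ (⟪ m ⟫ ℚ.+ ⟪ n ⟫)   ≡⟨ ℚ.+-assoc 1ℚ ⟪ m ⟫ ⟪ n ⟫ ⟨
  (1ℚ ℚ.+ ⟪ m ⟫) ℚ.+ ⟪ n ⟫   ≡⟨ cong (ℚ._+ ⟪ n ⟫) (fromℤ-suc m) ⟨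
  ⟪ suc m ⟫ ℚ.+ ⟪ n ⟫        ∎
  where open ≡-Reasoning

⟪⟫-* : ∀ m n → ⟪ m * n ⟫ ≡ ⟪ m ⟫ ℚ.* ⟪ n ⟫
⟪⟫-* zero    n = sym (ℚ.*-zeroˡ ⟪ n ⟫)
⟪⟫-* (suc m) n = begin
  ⟪ n + m * n ⟫               ≡⟨ ⟪⟫-+ n (m * n) ⟩
  ⟪ n ⟫ ℚ.+ ⟪ m * n ⟫           ≡⟨ cong₂ ℚ._+_ (sym (ℚ.*-identityˡ ⟪ n ⟫)) (⟪⟫-* m n) ⟩
  1ℚ ℚ.* ⟪ n ⟫ ℚ.+ ⟪ m ⟫ ℚ.* ⟪ n ⟫ ≡⟨ ℚ.*-distribʳ-+ ⟪ n ⟫ 1ℚ ⟪ m ⟫ ⟨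
  (1ℚ ℚ.+ ⟪ m ⟫) ℚ.* ⟪ n ⟫        ≡⟨ cong (ℚ._* ⟪ n ⟫) (fromℤ-suc m) ⟨
  ⟪ suc m ⟫ ℚ.* ⟪ n ⟫             ∎
  where open ≡-Reasoning

⟪⟫-mono-≤ : ∀ {m n} → m ≤ n → ⟪ m ⟫ ℚ.≤ ⟪ n ⟫
⟪⟫-mono-≤ m≤n = *≤* (ℤ.*-monoʳ-≤-nonNeg (+ 1) (ℤ.+≤+ m≤n))

⟪⟫-mono-< : ∀ {m n} → m < n → ⟪ m ⟫ ℚ.< ⟪ n ⟫
⟪⟫-mono-< m<n = *<* (ℤ.*-monoʳ-<-pos (+ 1) (ℤ.+<+ m<n))

⟪⟫-nonNeg : ∀ n → 0ℚ ℚ.≤ ⟪ n ⟫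
⟪⟫-nonNeg n = ⟪⟫-mono-≤ {0} {n} z≤n

⟪⟫*-mono-≤ : ∀ n {p r} → p ℚ.≤ r → ⟪ n ⟫ ℚ.* p ℚ.≤ ⟪ n ⟫ ℚ.* r
⟪⟫*-mono-≤ n = ℚ.*-monoˡ-≤-nonNeg ⟪ n ⟫ {{nonNegative (⟪⟫-nonNeg n)}}

⟪n⟫*1/n : ∀ n → ⟪ suc n ⟫ ℚ.* (+ 1 / suc n) ≡ 1ℚ
⟪n⟫*1/n n = trans
  (cong (⟪ suc n ⟫ ℚ.*_) (ℚ./-cong {+ 1} {q₁ = suc n} {q₂ = suc n * 1} refl (sym (*-identityʳ (suc n)))))
  (n*1/[n*k]≡1/k n 0)

0<1/n : ∀ n → 0ℚ ℚ.< + 1 / suc n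
0<1/n n = ℚ.positive⁻¹ (+ 1 / suc n) {{ℚ.normalize-pos 1 (suc n)}}

-- The lower sum of mesh 1/(m + 1) cut off after N terms, hence a lower bound for ln ((m + 1 + N)/(m
-- + 1)). `lowerSum q m` is the case N = (q - 1)(m + 1).
harmonic : ℕ → ℕ → ℚ
harmonic m N = sumBelow N λ i → + 1 / (suc m + suc i)

harmonic-nonNeg : ∀ m N → 0ℚ ℚ.≤ harmonic m N
harmonic-nonNeg m zero    = ℚ.≤-refl
harmonic-nonNeg m (suc N) = subst (ℚ._≤ harmonic m (suc N)) (ℚ.+-identityʳ 0ℚ)
  (ℚ.+-mono-≤ (harmonic-nonNeg m N) (ℚ.<⇒≤ (0<1/n (m + suc N))))

harmonic-block : ∀ m M K →
  harmonic m M ℚ.+ ⟪ K ⟫ ℚ.* (+ 1 / suc (m + (M + K))) ℚ.≤ harmonic m (M + K)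
harmonic-block m M K = begin
  harmonic m M ℚ.+ ⟪ K ⟫ ℚ.* u
    ≡⟨ cong (harmonic m M ℚ.+_) (sum-const K u) ⟨
  harmonic m M ℚ.+ sumBelow K (λ _ → u)
    ≤⟨ ℚ.+-monoʳ-≤ (harmonic m M) (sum-mono K λ j j<K → 1/-antimono
         (+-monoʳ-≤ m (≤-trans (≤-reflexive (sym (+-suc M j))) (+-monoʳ-≤ M j<K)))) ⟩
  harmonic m M ℚ.+ sumBelow K (λ j → + 1 / (suc m + suc (M + j)))
    ≡⟨ sum-+ M K (λ i → + 1 / (suc m + suc i)) ⟨
  harmonic m (M + K) ∎
  where
  open ℚ.≤-Reasoning
  u = + 1 / suc (m + (M + K))

-- Cut [e^N , (c+e)^N] at the points (c+e)^i e^(N-i): each block of the harmonic sum is at least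
-- its number of terms over its right end point, that is c/(c+e).
harmonic-chain : ∀ c e m i r → suc m ≡ e ^ (i + r) → ∀ M → suc m + M ≡ (c + e) ^ i * e ^ r →
  ⟪ i * c ⟫ ℚ.≤ ⟪ c + e ⟫ ℚ.* harmonic m M
harmonic-chain c e m zero r _ M _ = subst (ℚ._≤ ⟪ c + e ⟫ ℚ.* harmonic m M) (ℚ.*-zeroʳ ⟪ c + e ⟫)
  (⟪⟫*-mono-≤ (c + e) (harmonic-nonNeg m M))
harmonic-chain c e m (suc i) r m≡ M M≡ = begin
  ⟪ c + i * c ⟫
    ≡⟨ cong ⟪_⟫ (+-comm c (i * c)) ⟩
  ⟪ i * c + c ⟫
    ≡⟨ ⟪⟫-+ (i * c) c ⟩
  ⟪ i * c ⟫ ℚ.+ ⟪ c ⟫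
    ≤⟨ ℚ.+-monoˡ-≤ ⟪ c ⟫ (harmonic-chain c e m i (suc r) m≡′ M′ M′≡) ⟩
  ⟪ d ⟫ ℚ.* harmonic m M′ ℚ.+ ⟪ c ⟫
    ≡⟨ cong (⟪ d ⟫ ℚ.* harmonic m M′ ℚ.+_) (sym block≡) ⟩
  ⟪ d ⟫ ℚ.* harmonic m M′ ℚ.+ ⟪ d ⟫ ℚ.* (⟪ y * c ⟫ ℚ.* u)
    ≡⟨ ℚ.*-distribˡ-+ ⟪ d ⟫ (harmonic m M′) (⟪ y * c ⟫ ℚ.* u) ⟨
  ⟪ d ⟫ ℚ.* (harmonic m M′ ℚ.+ ⟪ y * c ⟫ ℚ.* u)
    ≤⟨ ⟪⟫*-mono-≤ d (harmonic-block m M′ (y * c)) ⟩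
  ⟪ d ⟫ ℚ.* harmonic m (M′ + y * c)
    ≡⟨ cong (λ k → ⟪ d ⟫ ℚ.* harmonic m k)
         (+-cancelˡ-≡ (suc m) _ _ (trans right≡ (trans (sym y*d≡) (sym M≡)))) ⟩
  ⟪ d ⟫ ℚ.* harmonic m M ∎
  where
  open ℚ.≤-Reasoning
  d = c + e
  -- The last block runs from y e to y d: it has y c terms, none below 1/(y d).
  y = d ^ i * e ^ r
  y*d≡ : d * d ^ i * e ^ r ≡ y * d
  y*d≡ = trans (*-assoc d (d ^ i) (e ^ r)) (*-comm d y)
  y*e≡ : d ^ i * (e * e ^ r) ≡ y * e
  y*e≡ = trans (cong (d ^ i *_) (*-comm e (e ^ r))) (sym (*-assoc (d ^ i) (e ^ r) e))
  m≡′ : suc m ≡ e ^ (i + suc r)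
  m≡′ = trans m≡ (cong (e ^_) (sym (+-suc i r)))
  m≤ : suc m ≤ d ^ i * (e * e ^ r)
  m≤ = subst (_≤ d ^ i * e ^ suc r) (sym (trans m≡′ (^-distribˡ-+-* e i (suc r))))
         (*-monoˡ-≤ (e ^ suc r) (^-monoˡ-≤ i (m≤n+m e c)))
  M′ = d ^ i * (e * e ^ r) ∸ suc m
  M′≡ : suc m + M′ ≡ d ^ i * (e * e ^ r)
  M′≡ = m+[n∸m]≡n m≤
  right≡ : suc m + (M′ + y * c) ≡ y * d
  right≡ = trans (sym (+-assoc (suc m) M′ (y * c)))
    (trans (cong (_+ y * c) (trans M′≡ y*e≡))
    (trans (sym (*-distribˡ-+ y e c)) (cong (y *_) (+-comm e c))))
  u = + 1 / suc (m + (M′ + y * c))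
  swap : ∀ d y c → d * (y * c) ≡ c * (y * d)
  swap = solve-∀
  block≡ : ⟪ d ⟫ ℚ.* (⟪ y * c ⟫ ℚ.* u) ≡ ⟪ c ⟫
  block≡ = begin-equality
    ⟪ d ⟫ ℚ.* (⟪ y * c ⟫ ℚ.* u)   ≡⟨ ℚ.*-assoc ⟪ d ⟫ ⟪ y * c ⟫ u ⟨
    ⟪ d ⟫ ℚ.* ⟪ y * c ⟫ ℚ.* u     ≡⟨ cong (ℚ._* u) (trans (sym (⟪⟫-* d (y * c)))
                                          (trans (cong ⟪_⟫ (swap d y c)) (⟪⟫-* c (y * d)))) ⟩
    ⟪ c ⟫ ℚ.* ⟪ y * d ⟫ ℚ.* u     ≡⟨ ℚ.*-assoc ⟪ c ⟫ ⟪ y * d ⟫ u ⟩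
    ⟪ c ⟫ ℚ.* (⟪ y * d ⟫ ℚ.* u)   ≡⟨ cong (λ k → ⟪ c ⟫ ℚ.* (⟪ k ⟫ ℚ.* u)) (sym right≡) ⟩
    ⟪ c ⟫ ℚ.* (⟪ suc (m + (M′ + y * c)) ⟫ ℚ.* u)
                                     ≡⟨ cong (⟪ c ⟫ ℚ.*_) (⟪n⟫*1/n (m + (M′ + y * c))) ⟩
    ⟪ c ⟫ ℚ.* 1ℚ                    ≡⟨ ℚ.*-identityʳ ⟪ c ⟫ ⟩
    ⟪ c ⟫ ∎

-- k² ≥ n ln q, tested on the lower sums that generate the lower cut of `ln q`, so that no product
-- of reals is needed. As a record it lets k, n and q be inferred.
infix 4 _²≥_ln_
record _²≥_ln_ (k n q : ℕ) : Set where
  constructor lowerSums-below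
  field n*lowerSum≤k² : ∀ m → ⟪ n ⟫ ℚ.* lowerSum q m ℚ.≤ ⟪ k * k ⟫

open _²≥_ln_

-- If k²/n ≤ N s with s = c/(c+e), then q ≤ (1 - s)^-N.
ln-bound⇒power-bound : ∀ {k n q} → k ²≥ n ln q → 0 < n → ∀ N c e .{{_ : NonZero e}} →
  k * k * (c + e) ≤ n * (N * c) → q * e ^ N ≤ (c + e) ^ N
ln-bound⇒power-bound {k} {n} {q} bound 0<n N c e kkd≤ = ≮⇒≥ impossible
  where
  d = c + e
  -- Mesh 1/e^N makes ((c + e)/e)^N a grid point, reached after M terms.
  m = pred (e ^ N)
  suc-m : suc m ≡ e ^ N
  suc-m = suc-pred (e ^ N) {{m^n≢0 e N}}
  M = d ^ N ∸ suc m
  M≡ : suc m + M ≡ d ^ N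
  M≡ = m+[n∸m]≡n (≤-trans (≤-reflexive suc-m) (^-monoˡ-≤ N (m≤n+m e c)))
  impossible : ¬ d ^ N < q * e ^ N
  impossible d^N< = ℚ.<-irrefl refl (begin-strict
    ⟪ n * (N * c) ⟫
      ≡⟨ ⟪⟫-* n (N * c) ⟩
    ⟪ n ⟫ ℚ.* ⟪ N * c ⟫
      ≤⟨ ⟪⟫*-mono-≤ n (harmonic-chain c e m N 0 (trans suc-m (cong (e ^_) (sym (+-identityʳ N))))
           M (trans M≡ (sym (*-identityʳ _)))) ⟩
    ⟪ n ⟫ ℚ.* (⟪ d ⟫ ℚ.* harmonic m M)
      <⟨ ℚ.*-monoʳ-<-pos ⟪ n ⟫ {{positive (⟪⟫-mono-< 0<n)}}
           (ℚ.*-monoʳ-<-pos ⟪ d ⟫ {{positive (⟪⟫-mono-< 0<d)}} longer) ⟩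
    ⟪ n ⟫ ℚ.* (⟪ d ⟫ ℚ.* lowerSum q m)
      ≡⟨ swap ⟪ n ⟫ ⟪ d ⟫ (lowerSum q m) ⟩
    ⟪ d ⟫ ℚ.* (⟪ n ⟫ ℚ.* lowerSum q m)
      ≤⟨ ⟪⟫*-mono-≤ d (n*lowerSum≤k² bound m) ⟩
    ⟪ d ⟫ ℚ.* ⟪ k * k ⟫
      ≡⟨ trans (sym (⟪⟫-* d (k * k))) (cong ⟪_⟫ (*-comm d (k * k))) ⟩
    ⟪ k * k * d ⟫
      ≤⟨ ⟪⟫-mono-≤ kkd≤ ⟩
    ⟪ n * (N * c) ⟫ ∎)
    where
    open ℚ.≤-Reasoning
    swap : ∀ a b c → a ℚ.* (b ℚ.* c) ≡ b ℚ.* (a ℚ.* c)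
    swap = solve 3 (λ a b c → a :* (b :* c) := b :* (a :* c)) refl
    0<d : 0 < d
    0<d = <-≤-trans (n≢0⇒n>0 (≢-nonZero⁻¹ e)) (m≤n+m e c)
    M<K : M < (q ∸ 1) * suc m
    M<K = subst (M <_) (trans (cong (q * suc m ∸_) (sym (*-identityˡ (suc m))))
                                (sym (*-distribʳ-∸ (suc m) q 1)))
            (∸-monoˡ-< (subst (λ z → d ^ N < q * z) (sym suc-m) d^N<)
               (m+n≤o⇒m≤o (suc m) (≤-reflexive M≡)))
    -- If q exceeds ((c + e)/e)^N, then `lowerSum q m` has at least one further positive term.
    longer : harmonic m M ℚ.< lowerSum q m
    longer = ℚ.<-≤-trans
      (p<p+ε (harmonic m M) (0<1/n (m + suc M)))
      (subst (λ z → harmonic m (suc M) ℚ.≤ harmonic m z) (m+[n∸m]≡n M<K)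
        (ℚ.≤-trans (subst (ℚ._≤ harmonic m (suc M) ℚ.+ ⟪ K ⟫ ℚ.* u) (ℚ.+-identityʳ _)
           (ℚ.+-monoʳ-≤ (harmonic m (suc M)) (subst (ℚ._≤ ⟪ K ⟫ ℚ.* u) (ℚ.*-zeroʳ ⟪ K ⟫)
              (⟪⟫*-mono-≤ K (ℚ.<⇒≤ (0<1/n (m + (suc M + K))))))))
         (harmonic-block m (suc M) K)))
      where
      K = (q ∸ 1) * suc m ∸ suc M
      u = + 1 / suc (m + (suc M + K))

-- Ceilings as inequalities between natural numbers

open ℝ using (L; L-open)

-- Lower cuts are open, so l itself may fail to lie below x. Density splits the slack in r < n l
-- between one summand and the rest.
·-lower : ∀ n x l {r} → (∀ {s} → s ℚ.< l → L x s) → r ℚ.< ⟪ n ⟫ ℚ.* l → L (n · x) r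
·-lower zero    x l {r} Lx r<0 = subst (r ℚ.<_) (ℚ.*-zeroˡ l) r<0
·-lower (suc n) x l {r} Lx r<nl =
  let s , r-nl<s , s<l = ℚ.<-dense (shift r (⟪ n ⟫ ℚ.* l) l (subst (r ℚ.<_) split r<nl))
      t , r-s<t , t<nl = ℚ.<-dense (shift r s (⟪ n ⟫ ℚ.* l)
        (subst (r ℚ.<_) (ℚ.+-comm s (⟪ n ⟫ ℚ.* l)) (unshift r (⟪ n ⟫ ℚ.* l) s r-nl<s)))
  in s , t , Lx s<l , ·-lower n x l Lx t<nl , subst (r ℚ.<_) (ℚ.+-comm t s) (unshift r s t r-s<t)
  where
  split : ⟪ suc n ⟫ ℚ.* l ≡ l ℚ.+ ⟪ n ⟫ ℚ.* l
  split = trans (cong (ℚ._* l) (fromℤ-suc n))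
    (solve 2 (λ a l → (con 1ℚ :+ a) :* l := l :+ a :* l) refl ⟪ n ⟫ l)
  cancel : ∀ a b → (a ℚ.+ b) - b ≡ a
  cancel = solve 2 (λ a b → (a :+ b) :- b := a) refl
  cancel′ : ∀ a b → (a - b) ℚ.+ b ≡ a
  cancel′ = solve 2 (λ a b → (a :- b) :+ b := a) refl
  shift : ∀ r b a → r ℚ.< a ℚ.+ b → r - b ℚ.< a
  shift r b a r<a+b = subst (r - b ℚ.<_) (cancel a b) (ℚ.+-monoˡ-< (ℚ.- b) r<a+b)
  unshift : ∀ r b a → r - b ℚ.< a → r ℚ.< a ℚ.+ b
  unshift r b a r-b<a = subst (ℚ._< a ℚ.+ b) (cancel′ r b) (ℚ.+-monoˡ-< b r-b<a)

-- Every negative rational lies below the root, so a ≥ 0. A lower sum with k² < n · `lowerSum q m`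
-- would put k² below n ln q, and hence k below the root.
ceiling-√-ln : ∀ {n q a} → IsCeiling (√ (n · ln q)) a → ∃[ k ] a ≡ + k × k ²≥ n ln q
ceiling-√-ln {a = -[1+ j ]} (_ , ¬L) = contradiction (inj₁ (*<* ℤ.-<+)) ¬L
ceiling-√-ln {n} {q} {+ k} (_ , ¬L) = k , refl , lowerSums-below λ m → ℚ.≮⇒≥ λ kk< →
  ¬L (inj₂ (subst (L (n · ln q)) (⟪⟫-* k k)
    (·-lower n (ln q) (lowerSum q m) (λ s< → m , s<) kk<)))

½<√q : ∀ {q} → 0 < q → L (√ (fromℕ q)) ½
½<√q 0<q = inj₂ (ℚ.<-≤-trans (from-yes (½ ℚ.* ½ ℚ.<? 1ℚ)) (⟪⟫-mono-≤ 0<q))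

-- If (2c + 1)² < q, then 2 (c + 1) < √q + 1, and c + 1 would be too small for the ceiling. Values b
-- ≤ 0 are excluded by 2b < ½ + ½ with ½ < √q and ½ < 1.
ceiling-half-√ : ∀ {q b} → 0 < q → IsCeiling ((√ (fromℕ q) ⊕ fromℕ 1) /2) b →
  ∃[ c ] b ≡ + suc c × q ≤ suc (2 * c) * suc (2 * c)
ceiling-half-√ {q} {+ suc c} 0<q (_ , ¬L) = c , refl , ≮⇒≥ λ odd²<q →
  -- Openness gives s > 2c + 1 still below √q; this leaves room for some t < 1 with s + t > 2c + 2.
  let s , odd<s , Ls = L-open (√ (fromℕ q)) {⟪ suc (2 * c) ⟫}
        (inj₂ (subst (ℚ._< ⟪ q ⟫) (⟪⟫-* (suc (2 * c)) (suc (2 * c))) (⟪⟫-mono-< odd²<q)))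
      t , s′<t , t<1 = ℚ.<-dense (below s odd<s)
  in ¬L (s , t , Ls , t<1 , unshift s t s′<t)
  where
  double : ⟪ suc c ⟫ ℚ.+ ⟪ suc c ⟫ ≡ 1ℚ ℚ.+ ⟪ suc (2 * c) ⟫
  double = trans (sym (⟪⟫-+ (suc c) (suc c))) (trans (cong ⟪_⟫ (eq c)) (fromℤ-suc (suc (2 * c))))
    where
    eq : ∀ c → suc c + suc c ≡ suc (suc (2 * c))
    eq = solve-∀
  below : ∀ s → ⟪ suc (2 * c) ⟫ ℚ.< s → (⟪ suc c ⟫ ℚ.+ ⟪ suc c ⟫) - s ℚ.< 1ℚ
  below s odd<s = subst₂ ℚ._<_ (cong (_- s) (sym double))
    (solve 1 (λ s → (con 1ℚ :+ s) :- s := con 1ℚ) refl s)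
    (ℚ.+-monoˡ-< (ℚ.- s) (ℚ.+-monoʳ-< 1ℚ odd<s))
  unshift : ∀ s t → (⟪ suc c ⟫ ℚ.+ ⟪ suc c ⟫) - s ℚ.< t → ⟪ suc c ⟫ ℚ.+ ⟪ suc c ⟫ ℚ.< s ℚ.+ t
  unshift s t lt = subst (ℚ._< s ℚ.+ t)
    (solve 2 (λ a s → s :+ (a :- s) := a) refl (⟪ suc c ⟫ ℚ.+ ⟪ suc c ⟫) s)
    (ℚ.+-monoʳ-< s lt)
ceiling-half-√ {q} {+ zero} 0<q (_ , ¬L) = contradiction
  (½ , ½ , ½<√q 0<q , from-yes (½ ℚ.<? 1ℚ) , from-yes (0ℚ ℚ.+ 0ℚ ℚ.<? ½ ℚ.+ ½)) ¬L
ceiling-half-√ {q} { -[1+ j ]} 0<q (_ , ¬L) = contradiction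
  (½ , ½ , ½<√q 0<q , from-yes (½ ℚ.<? 1ℚ) ,
   ℚ.<-trans (ℚ.+-mono-< neg<0 neg<0) (from-yes (0ℚ ℚ.+ 0ℚ ℚ.<? ½ ℚ.+ ½))) ¬L
  where
  neg<0 : fromℤ -[1+ j ] ℚ.< 0ℚ
  neg<0 = *<* ℤ.-<+

-- Estimates for the greedy product

-- (x + 1)(x + 2)⋯(x + n): the first factor is x + 1, not x.
rising : ℕ → ℕ → ℕ
rising x zero    = 1
rising x (suc n) = suc x * rising (suc x) n

rising-last : ∀ x n → rising x (suc n) ≡ rising x n * suc (x + n)
rising-last x zero    = trans (*-identityʳ (suc x)) (sym (trans (+-identityʳ _) (cong suc (+-identityʳ x))))
rising-last x (suc n) = trans (cong (suc x *_) (rising-last (suc x) n))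
  (trans (sym (*-assoc (suc x) (rising (suc x) n) (suc (suc x + n))))
         (cong (λ z → suc x * rising (suc x) n * suc z) (sym (+-suc x n))))

-- The two outermost factors are paired by AM-GM, and `greedy-count<√q` keeps one such pair exact.
rising-ends : ∀ x n → rising x (2 + n) ≡ suc x * (2 + x + n) * rising (suc x) n
rising-ends x n = trans (cong (suc x *_) (rising-last (suc x) n)) (rotate (suc x) (rising (suc x) n) (2 + x + n))
  where
  rotate : ∀ a b c → a * (b * c) ≡ a * c * b
  rotate = solve-∀

-- AM-GM applied to the pairs of factors at equal distance from the ends.
rising-AMGM : ∀ n x → 2 ^ n * rising x n ≤ (2 * x + suc n) ^ n
rising-AMGM zero          x = ≤-refl
rising-AMGM (suc zero)    x = ≤-reflexive (eq x)
  where
  eq : ∀ x → 2 * 1 * (suc x * 1) ≡ (2 * x + 2) * 1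
  eq = solve-∀
rising-AMGM (suc (suc n)) x = begin
  2 * (2 * 2 ^ n) * rising x (2 + n)
    ≡⟨ cong (2 * (2 * 2 ^ n) *_) (rising-ends x n) ⟩
  2 * (2 * 2 ^ n) * (suc x * (2 + x + n) * rising (suc x) n)
    ≡⟨ regroup (2 ^ n) x n (rising (suc x) n) ⟩
  4 * (suc x * (2 + x + n)) * (2 ^ n * rising (suc x) n)
    ≤⟨ *-mono-≤ (m+n≤o⇒m≤o (4 * (suc x * (2 + x + n))) (≤-reflexive (pair x n))) (rising-AMGM n (suc x)) ⟩
  (2 * x + suc (suc (suc n))) * (2 * x + suc (suc (suc n))) * (2 * suc x + suc n) ^ n
    ≡⟨ cong (λ z → a * a * z ^ n) (centre x n) ⟩
  a * a * a ^ n
    ≡⟨ *-assoc a a (a ^ n) ⟩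
  a ^ (2 + n) ∎
  where
  open ≤-Reasoning
  a = 2 * x + suc (suc (suc n))
  regroup : ∀ p x n r → 2 * (2 * p) * (suc x * (2 + x + n) * r) ≡ 4 * (suc x * (2 + x + n)) * (p * r)
  regroup = solve-∀
  -- 4ab + (b - a)² = (a + b)² for the outer factors a and b, whose difference is n + 1.
  pair : ∀ x n → 4 * (suc x * (2 + x + n)) + suc n * suc n
         ≡ (2 * x + suc (suc (suc n))) * (2 * x + suc (suc (suc n)))
  pair = solve-∀
  centre : ∀ x n → 2 * suc x + suc n ≡ 2 * x + suc (suc (suc n))
  centre = solve-∀

-- The first two terms of the expansion of ∏ (B + (m + t)), times 2B.
rising-expand : ∀ B m N → B ^ N * (B * 2 + N * (2 * m + suc N)) ≤ B * 2 * rising (B + m) N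
rising-expand B m zero    = ≤-reflexive (eq B)
  where
  eq : ∀ B → 1 * (B * 2 + 0) ≡ B * 2 * 1
  eq = solve-∀
rising-expand B m (suc N) = begin
  B * B ^ N * (B * 2 + suc N * (2 * m + suc (suc N)))
    -- The added term is the part of the next product that the two-term bound discards.
    ≤⟨ m≤m+n _ (B ^ N * (N * (2 * m + suc N)) * (m + suc N)) ⟩
  B * B ^ N * (B * 2 + suc N * (2 * m + suc (suc N))) + B ^ N * (N * (2 * m + suc N)) * (m + suc N)
    ≡⟨ expand B (B ^ N) m N ⟩
  B ^ N * (B * 2 + N * (2 * m + suc N)) * suc (B + m + N)
    ≤⟨ *-monoˡ-≤ (suc (B + m + N)) (rising-expand B m N) ⟩
  B * 2 * rising (B + m) N * suc (B + m + N)
    ≡⟨ trans (*-assoc (B * 2) _ _) (cong (B * 2 *_) (sym (rising-last (B + m) N))) ⟩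
  B * 2 * rising (B + m) (suc N) ∎
  where
  open ≤-Reasoning
  expand : ∀ B p m N → B * p * (B * 2 + suc N * (2 * m + suc (suc N))) +
                       p * (N * (2 * m + suc N)) * (m + suc N)
                     ≡ p * (B * 2 + N * (2 * m + suc N)) * suc (B + m + N)
  expand = solve-∀

-- The polynomial inequality behind the greedy bound

cube : ℕ → ℕ
cube a = a * (a * a)

-- Numerals stand on the right of _*_, where they do not unfold into repeated sums.
gap-m≡0 : ∀ e {q X t r} → q ≡ e + 6 → X ≡ e + 6 → t ≡ e + 5 → r ≡ e + 5 →
  cube q * t * 16 < (q * q * 2 + r * X) * cube X
gap-m≡0 e refl refl refl refl =
  <-≤-trans (m<m+n _ (<-≤-trans z<s (m≤n+m 4752 _))) (≤-reflexive (eq e))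
  where
  eq : ∀ e → (e + 6) * ((e + 6) * (e + 6)) * (e + 5) * 16 +
         (e * 6480 + (e * e) * 3096 + (e * (e * e)) * 688 + (e * (e * (e * e))) * 73 +
          (e * (e * (e * (e * e)))) * 3 + 4752)
       ≡ ((e + 6) * (e + 6) * 2 + (e + 5) * (e + 6)) * ((e + 6) * ((e + 6) * (e + 6)))
  eq = solve-∀

-- The two sides differ by a polynomial with nonnegative coefficients and constant term 4800. Here m
-- stands for the original m less 1, and e for k - 6. Without this shift m² would have the
-- coefficient -144, which is why m = 0 is a separate case.
gap-0<m : ∀ m e {q X t r} → q ≡ m + e + 7 → X ≡ m + m + e + 8 → t ≡ (m + e + 6) * (m + 2) → r ≡ e + 5 →
  cube q * t * 16 < (q * q * 2 + r * X) * cube X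
gap-0<m m e refl refl refl refl =
  <-≤-trans (m<m+n _ (<-≤-trans z<s (m≤n+m 4800 _))) (≤-reflexive (eq m e))
  where
  eq : ∀ m e → (m + e + 7) * ((m + e + 7) * (m + e + 7)) * ((m + e + 6) * (m + 2)) * 16 +
          (m * (e * 2288 + (e * e) * 1020 + (e * (e * e)) * 156 + (e * (e * (e * e))) * 8 + 320) +
           (m * m) * (e * 600 + (e * e) * 144 + (e * (e * e)) * 10 + 528) +
           (m * (m * m)) * (e * 128 + (e * e) * 12 + 288) +
           (m * (m * (m * m))) * (e * 8 + 32) +
           e * 8288 + (e * e) * 3984 + (e * (e * e)) * 834 + (e * (e * (e * e))) * 81 +
           (e * (e * (e * (e * e)))) * 3 + 4800)
       ≡ ((m + e + 7) * (m + e + 7) * 2 + (e + 5) * (m + m + e + 8)) *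
         ((m + m + e + 8) * ((m + m + e + 8) * (m + m + e + 8)))
  eq = solve-∀

-- With q = m + k, k = n + 3 and X = 2q - k this reads
-- 16 q³ (q - 1)(q - k + 1) < (2q² + (k - 1)X) X³. The factors q - 1 and q - k + 1 are those kept
-- out of AM-GM, without which the inequality would fail for k close to q.
Gap : ℕ → ℕ → Set
Gap m n = cube (m + k) * ((2 + m + n) * suc m) * 16 < ((m + k) * (m + k) * 2 + (2 + n) * X) * cube X
  where
  k = 3 + n
  X = 2 * m + k

gap : ∀ m n → 3 ≤ n → Gap m n
gap m n 3≤n with n ∸ 3 | m+[n∸m]≡n 3≤n
gap zero    _ _ | e | refl =
  gap-m≡0 e (+-comm 6 e) (+-comm 6 e) (trans (*-identityʳ (5 + e)) (+-comm 5 e)) (+-comm 5 e)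
gap (suc m) _ _ | e | refl = gap-0<m m e (eq₁ m e) (eq₂ m e) (eq₃ m e) (+-comm 5 e)
  where
  eq₁ : ∀ m e → suc m + (6 + e) ≡ m + e + 7
  eq₁ = solve-∀
  eq₂ : ∀ m e → 2 * suc m + (6 + e) ≡ m + m + e + 8
  eq₂ = solve-∀
  eq₃ : ∀ m e → (2 + suc m + (3 + e)) * suc (suc m) ≡ (m + e + 6) * (m + 2)
  eq₃ = solve-∀

-- The logarithm bound combined with the greedy product

^-distribʳ-* : ∀ n a b → (a * b) ^ n ≡ a ^ n * b ^ n
^-distribʳ-* zero    a b = refl
^-distribʳ-* (suc n) a b = trans (cong (a * b *_) (^-distribʳ-* n a b)) (mid a b (a ^ n) (b ^ n))
  where
  mid : ∀ a b c d → a * b * (c * d) ≡ a * c * (b * d)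
  mid = solve-∀

-- N = 2k and s = k/6q in ln-bound⇒power-bound, together with (1 - k/6q)³ ≥ 1 - k/2q.
power-bound³ : ∀ {q} m k → q ≡ m + k → 0 < q → k ²≥ 3 * q ln q →
  cube q * (2 * m + k) ^ (k + k) ≤ (2 * q) ^ (k + k)
power-bound³ {q} m k refl 0<q bound = *-cancelˡ-≤ (b ^ K) {{m^n≢0 b K}} (begin
  b ^ K * (cube q * X ^ K)
    ≡⟨ swap (b ^ K) (cube q) (X ^ K) ⟩
  cube q * (b ^ K * X ^ K)
    ≡⟨ cong (cube q *_) (sym (^-distribʳ-* K b X)) ⟩
  cube q * (b * X) ^ K
    ≤⟨ *-monoʳ-≤ (cube q) (^-monoˡ-≤ K (m+n≤o⇒m≤o (b * X) (≤-reflexive (bernoulli m k)))) ⟩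
  cube q * (cube e) ^ K
    ≡⟨ cong (cube q *_) (cube-^ e K) ⟩
  cube q * cube (e ^ K)
    ≡⟨ cube-* q (e ^ K) ⟨
  cube (q * e ^ K)
    ≤⟨ *-mono-≤ root (*-mono-≤ root root) ⟩
  cube ((k + e) ^ K)
    ≡⟨ cube-^ (k + e) K ⟨
  cube (k + e) ^ K
    ≡⟨ cong (_^ K) (cube-6q m k) ⟩
  (b * (2 * q)) ^ K
    ≡⟨ ^-distribʳ-* K b (2 * q) ⟩
  b ^ K * (2 * q) ^ K ∎)
  where
  open ≤-Reasoning
  K = k + k
  X = 2 * m + k
  -- e = 6q - k. The scale b = 108 q² gives b · 2q = (6q)³ and b X = (6q)³ (1 - k/2q), so that no
  -- fractions occur.
  e = 6 * m + 5 * k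
  b = q * q * 108
  instance
    q≢0 = >-nonZero 0<q
    b≢0 = m*n≢0 (q * q) 108 {{m*n≢0 q q}}
    e≢0 : NonZero e
    e≢0 = >-nonZero (<-≤-trans 0<q (+-mono-≤ (m≤n*m m 6) (m≤n*m k 5)))
  cube-^ : ∀ a n → cube a ^ n ≡ cube (a ^ n)
  cube-^ a n = trans (^-distribʳ-* n a (a * a)) (cong (a ^ n *_) (^-distribʳ-* n a a))
  cube-* : ∀ a b → a * b * (a * b * (a * b)) ≡ a * (a * a) * (b * (b * b))
  cube-* = solve-∀
  swap : ∀ a b c → a * (b * c) ≡ b * (a * c)
  swap = solve-∀
  bernoulli : ∀ m k → (m + k) * (m + k) * 108 * (2 * m + k) + (m * (k * k) * 18 + k * (k * k) * 17)
              ≡ (6 * m + 5 * k) * ((6 * m + 5 * k) * (6 * m + 5 * k))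
  bernoulli = solve-∀
  cube-6q : ∀ m k → (k + (6 * m + 5 * k)) * ((k + (6 * m + 5 * k)) * (k + (6 * m + 5 * k)))
            ≡ (m + k) * (m + k) * 108 * (2 * (m + k))
  cube-6q = solve-∀
  steps : ∀ m k → k * k * (k + (6 * m + 5 * k)) ≡ 3 * (m + k) * ((k + k) * k)
  steps = solve-∀
  root : q * e ^ K ≤ (k + e) ^ K
  root = ln-bound⇒power-bound bound (m<n⇒m<o*n 3 0<q) K k e (≤-reflexive (steps m k))

-- With W = (2q)^k and Z = (2q - k)^k, the hypothesis on R and `Gap` give R W < q² Z. Squaring and
-- q³ Z² ≤ W² leave R² < q.
greedy-count<√q : ∀ m n {q} → q ≡ m + (3 + n) → Gap m n → (3 + n) ²≥ 3 * q ln q → ∀ R →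
  R * rising (q * q + m) (2 + n) ≤ q ^ (4 + n) * rising m (2 + n) → R * R < q
greedy-count<√q m n refl _ _ zero _ = <-≤-trans z<s (m≤n+m (3 + n) m)
greedy-count<√q m n {q} q≡ g bound R@(suc _) R≤ = *-cancelʳ-< (W * W) (R * R) q (begin-strict
  R * R * (W * W)
    ≡⟨ interchange R W ⟩
  R * W * (R * W)
    <⟨ *-mono-< RW< RW< ⟩
  q * q * Z * (q * q * Z)
    ≡⟨ collect q Z ⟩
  q * (cube q * (Z * Z))
    ≡⟨ cong (λ z → q * (cube q * z)) (^-distribˡ-+-* X k k) ⟨
  q * (cube q * X ^ (k + k))
    ≤⟨ *-monoʳ-≤ q (power-bound³ m k q≡ 0<q bound) ⟩
  q * (2 * q) ^ (k + k)
    ≡⟨ cong (q *_) (^-distribˡ-+-* (2 * q) k k) ⟩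
  q * (W * W) ∎)
  where
  open ≤-Reasoning
  N = 2 + n
  k = 3 + n
  X = 2 * m + k
  W = (2 * q) ^ k
  Z = X ^ k
  p = 2 ^ n
  u = q ^ n
  v = X ^ n
  M = (2 + m + n) * suc m
  B = q * q
  0<q : 0 < q
  0<q = subst (0 <_) (sym q≡) (<-≤-trans z<s (m≤n+m k m))
  instance
    q≢0 = >-nonZero 0<q
    B≢0 = m*n≢0 q q
    p≢0 = m^n≢0 2 n
    B^N≢0 = m^n≢0 B N
  interchange : ∀ a b → a * a * (b * b) ≡ a * b * (a * b)
  interchange = solve-∀
  collect : ∀ q z → q * q * z * (q * q * z) ≡ q * (q * (q * q) * (z * z))
  collect = solve-∀
  C = B * 2 * (q * (q * (q * (q * u)))) * M
  -- All denominators are cleared by C. `rising-expand` bounds the product of the q² + m + t from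
  -- below, AM-GM bounds the inner n of the m + t from above, and `Gap` compares what is left.
  scaled : C * (p * R * q * u * 8) < C * Z
  scaled = begin-strict
    C * (p * R * q * u * 8)
      ≡⟨ eq₁ q u M p R ⟩
    p * R * (B * (B * (u * u))) * (cube q * M * 16)
      ≡⟨ cong (λ z → p * R * (B * (B * z)) * (cube q * M * 16)) (^-distribʳ-* n q q) ⟨
    p * R * B ^ N * (cube q * M * 16)
      <⟨ *-monoʳ-< (p * R * B ^ N) {{m*n≢0 (p * R) (B ^ N) {{m*n≢0 p R}}}}
           (subst (λ z → cube z * M * 16 < (z * z * 2 + N * X) * cube X) (sym q≡) g) ⟩
    p * R * B ^ N * ((B * 2 + N * X) * cube X)
      ≡⟨ eq₂ p R (B ^ N) (B * 2 + N * X) (cube X) ⟩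
    p * cube X * R * (B ^ N * (B * 2 + N * X))
      ≤⟨ *-monoʳ-≤ (p * cube X * R) (rising-expand B m N) ⟩
    p * cube X * R * (B * 2 * rising (B + m) N)
      ≡⟨ eq₃ (p * cube X) R (B * 2) (rising (B + m) N) ⟩
    p * cube X * (B * 2) * (R * rising (B + m) N)
      ≤⟨ *-monoʳ-≤ (p * cube X * (B * 2)) R≤ ⟩
    p * cube X * (B * 2) * (q ^ (4 + n) * rising m N)
      ≡⟨ cong (λ z → p * cube X * (B * 2) * (q ^ (4 + n) * z)) (rising-ends m n) ⟩
    p * cube X * (B * 2) * (q ^ (4 + n) * (suc m * (2 + m + n) * rising (suc m) n))
      ≡⟨ eq₄ p (cube X) (B * 2) (q ^ (4 + n)) (suc m) (2 + m + n) (rising (suc m) n) ⟩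
    B * 2 * q ^ (4 + n) * M * (cube X * (p * rising (suc m) n))
      ≤⟨ *-monoʳ-≤ C (*-monoʳ-≤ (cube X) (subst (λ z → p * rising (suc m) n ≤ z ^ n)
           (centre m n) (rising-AMGM n (suc m)))) ⟩
    C * (cube X * v)
      ≡⟨ cong (C *_) (eq₅ X v) ⟩
    C * Z ∎
    where
    eq₁ : ∀ q u M p R → q * q * 2 * (q * (q * (q * (q * u)))) * M * (p * R * q * u * 8)
          ≡ p * R * (q * q * (q * q * (u * u))) * (q * (q * q) * M * 16)
    eq₁ = solve-∀
    eq₂ : ∀ p R b t x → p * R * b * (t * x) ≡ p * x * R * (b * t)
    eq₂ = solve-∀
    eq₃ : ∀ a R b d → a * R * (b * d) ≡ a * b * (R * d)
    eq₃ = solve-∀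
    eq₄ : ∀ p x b w s t r → p * x * b * (w * (s * t * r)) ≡ b * w * (t * s) * (x * (p * r))
    eq₄ = solve-∀
    eq₅ : ∀ x v → x * (x * x) * v ≡ x * (x * (x * v))
    eq₅ = solve-∀
    centre : ∀ m n → 2 * suc m + suc n ≡ 2 * m + (3 + n)
    centre = solve-∀
  RW< : R * W < B * Z
  RW< = begin-strict
    R * W
      ≡⟨ cong (λ z → R * (2 * q * (2 * q * (2 * q * z)))) (^-distribʳ-* n 2 q) ⟩
    R * (2 * q * (2 * q * (2 * q * (p * u))))
      ≡⟨ eq R q p u ⟩
    B * (p * R * q * u * 8)
      <⟨ *-monoʳ-< B (*-cancelˡ-< C _ _ scaled) ⟩
    B * Z ∎
    where
    eq : ∀ R q p u → R * (2 * q * (2 * q * (2 * q * (p * u)))) ≡ q * q * (p * R * q * u * 8)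
    eq = solve-∀

-- The contrapositive of `ln-bound⇒power-bound`: k ≤ k₀ would force q ≤ (1 + c/e)^N.
no-small-k : ∀ {k q} k₀ N c e .{{_ : NonZero e}} → k ²≥ 3 * q ln q → 0 < q →
  k₀ * k₀ * (c + e) ≤ 3 * q * (N * c) → (c + e) ^ N < q * e ^ N → k₀ < k
no-small-k {k} {q} k₀ N c e bound 0<q k₀-bound power = ≰⇒> λ k≤k₀ → <⇒≱ power
  (ln-bound⇒power-bound bound (m<n⇒m<o*n 3 0<q) N c e
    (≤-trans (*-monoˡ-≤ (c + e) (*-mono-≤ k≤k₀ k≤k₀)) k₀-bound))

-- The constants passed to no-small-k are chosen such that (1 + c/e)^N, which exceeds exp (k₀²/3q),
-- is still less than q. For q ≤ 4 they give k > q.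
gap-applies : ∀ q k → 2 ≤ q → k ≤ q → k ²≥ 3 * q ln q →
  ∃[ m ] ∃[ n ] q ≡ m + (3 + n) × k ≡ 3 + n × Gap m n
gap-applies 0 k () k≤q bound
gap-applies 1 k (s≤s ()) k≤q bound
gap-applies 2 k _ k≤q bound = contradiction k≤q (<⇒≱
  (no-small-k 2 10 1 14 bound z<s (≤ᵇ⇒≤ _ _ _) (<ᵇ⇒< _ _ _)))
gap-applies 3 k _ k≤q bound = contradiction k≤q (<⇒≱
  (no-small-k 3 6 1 5 bound z<s (≤ᵇ⇒≤ _ _ _) (<ᵇ⇒< _ _ _)))
gap-applies 4 k _ k≤q bound = contradiction k≤q (<⇒≱
  (no-small-k 4 20 1 14 bound z<s (≤ᵇ⇒≤ _ _ _) (<ᵇ⇒< _ _ _)))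
-- Here k = q = 5, short of the k ≥ 6 that `gap` asks for, so the inequality is evaluated.
gap-applies 5 k _ k≤q bound = 0 , 2 , refl ,
  ≤-antisym k≤q (no-small-k 4 2 8 7 bound z<s (≤ᵇ⇒≤ _ _ _) (<ᵇ⇒< _ _ _)) ,
  <ᵇ⇒< _ _ _
gap-applies q@(suc (suc (suc (suc (suc (suc r)))))) k _ k≤q bound =
  q ∸ k , k ∸ 3 ,
  sym (trans (cong (_+_ (q ∸ k)) (m+[n∸m]≡n 3≤k)) (m∸n+n≡m k≤q)) ,
  sym (m+[n∸m]≡n 3≤k) ,
  gap (q ∸ k) (k ∸ 3) (∸-monoˡ-≤ 3 6≤k)
  where
  6≤q : 6 ≤ q
  6≤q = m≤m+n 6 r
  6≤k : 6 ≤ k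
  -- Both numerical conditions get weaker as q grows, so that q = 6 decides.
  6≤k = no-small-k 5 5 5 13 bound z<s
    (*-monoˡ-≤ 25 (*-monoʳ-≤ 3 6≤q))
    (<-≤-trans (<ᵇ⇒< (18 ^ 5) (6 * 13 ^ 5) _) (*-monoˡ-≤ (13 ^ 5) 6≤q))
  3≤k : 3 ≤ k
  3≤k = ≤-trans (m≤m+n 3 3) 6≤k

-- Finite sums and indicators

private variable
  n : ℕ
  P Q : Set

⟦_⟧ : Dec P → ℕ
⟦ P? ⟧ = if does P? then 1 else 0

⟦⟧-yes : (P? : Dec P) → P → ⟦ P? ⟧ ≡ 1
⟦⟧-yes P? p = cong (if_then 1 else 0) (dec-true P? p)

⟦⟧-no : (P? : Dec P) → ¬ P → ⟦ P? ⟧ ≡ 0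
⟦⟧-no P? ¬p = cong (if_then 1 else 0) (dec-false P? ¬p)

⟦⟧≤1 : (P? : Dec P) → ⟦ P? ⟧ ≤ 1
⟦⟧≤1 (yes _) = ≤-refl
⟦⟧≤1 (no _)  = z≤n

0<⟦⟧⇒ : (P? : Dec P) → 0 < ⟦ P? ⟧ → P
0<⟦⟧⇒ (yes p) _ = p

⟦⟧-mono : (P? : Dec P) (Q? : Dec Q) → (P → Q) → ⟦ P? ⟧ ≤ ⟦ Q? ⟧
⟦⟧-mono (yes p) Q? P⇒Q = ≤-reflexive (sym (⟦⟧-yes Q? (P⇒Q p)))
⟦⟧-mono (no _)  Q? P⇒Q = z≤n

⟦⟧-cong : (P? : Dec P) (Q? : Dec Q) → (P → Q) → (Q → P) → ⟦ P? ⟧ ≡ ⟦ Q? ⟧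
⟦⟧-cong P? Q? P⇒Q Q⇒P = ≤-antisym (⟦⟧-mono P? Q? P⇒Q) (⟦⟧-mono Q? P? Q⇒P)

⟦⟧-× : (P? : Dec P) (Q? : Dec Q) → ⟦ P? ⟧ * ⟦ Q? ⟧ ≡ ⟦ P? ×-dec Q? ⟧
⟦⟧-× (yes _) Q? = +-identityʳ ⟦ Q? ⟧
⟦⟧-× (no _)  Q? = refl

⟦⟧+⟦¬⟧ : (P? : Dec P) → ⟦ P? ⟧ + ⟦ ¬? P? ⟧ ≡ 1
⟦⟧+⟦¬⟧ (yes _) = refl
⟦⟧+⟦¬⟧ (no _)  = refl

∑-mono : {f g : Vector ℕ n} → (∀ x → f x ≤ g x) → sum f ≤ sum g
∑-mono {zero}  f≤g = z≤n
∑-mono {suc n} f≤g = +-mono-≤ (f≤g zero) (∑-mono (f≤g ∘ suc))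

∑-const : ∀ n c → ∑[ x < n ] c ≡ n * c
∑-const zero    c = refl
∑-const (suc n) c = cong (_+_ c) (∑-const n c)

term≤∑ : (f : Vector ℕ n) (x : Fin n) → f x ≤ sum f
term≤∑ f zero    = m≤m+n (f zero) _
term≤∑ f (suc x) = ≤-trans (term≤∑ (f ∘ suc) x) (m≤n+m _ (f zero))

0<∑⇒∃ : (f : Vector ℕ n) → 0 < sum f → ∃[ x ] 0 < f x
0<∑⇒∃ {suc n} f 0<∑ with f zero in f₀
... | suc _ = zero , subst (0 <_) (sym f₀) z<s
... | zero  = let x , 0<fx = 0<∑⇒∃ (f ∘ suc) 0<∑ in suc x , 0<fx

∑-select : (a : Fin n) (f : Vector ℕ n) → ∑[ x < n ] (⟦ x ≟ᶠ a ⟧ * f x) ≡ f a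
∑-select {suc n} zero    f =
  trans (cong₂ _+_ (+-identityʳ (f zero)) (trans (∑-const n 0) (*-zeroʳ n))) (+-identityʳ (f zero))
∑-select {suc n} (suc a) f = ∑-select a (f ∘ suc)

∑-⟦≟⟧ : (a : Fin n) → ∑[ x < n ] ⟦ x ≟ᶠ a ⟧ ≡ 1
∑-⟦≟⟧ a = trans (sum-cong-≗ (λ x → sym (*-identityʳ ⟦ x ≟ᶠ a ⟧))) (∑-select a (λ _ → 1))

∑-∃! : {R : Fin n → Set} (R? : Decidable R) → ∃! _≡_ R → ∑[ x < n ] ⟦ R? x ⟧ ≡ 1
∑-∃! {R = R} R? (a , Ra , unique) = trans
  (sum-cong-≗ λ x → ⟦⟧-cong (R? x) (x ≟ᶠ a) (λ Rx → sym (unique Rx)) (λ x≡a → subst R (sym x≡a) Ra))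
  (∑-⟦≟⟧ a)

∑-atMostOne : (f : Vector ℕ n) → (∀ x → f x ≤ 1) → (∀ x y → 0 < f x → 0 < f y → x ≡ y) → sum f ≤ 1
∑-atMostOne {n} f f≤1 inj with any? (λ x → 0 <? f x)
... | no none = ≤-trans (∑-mono {g = λ _ → 0} λ x → ≮⇒≥ λ 0<fx → none (x , 0<fx))
                        (≤-trans (≤-reflexive (trans (∑-const n 0) (*-zeroʳ n))) z≤n)
... | yes (a , 0<fa) = ≤-trans (∑-mono bound) (≤-reflexive (∑-⟦≟⟧ a))
  where
  bound : ∀ x → f x ≤ ⟦ x ≟ᶠ a ⟧
  bound x with 0 <? f x
  ... | yes 0<fx = ≤-trans (f≤1 x) (≤-reflexive (sym (⟦⟧-yes (x ≟ᶠ a) (inj x a 0<fx 0<fa))))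
  ... | no  0≮fx = ≤-trans (≮⇒≥ 0≮fx) z≤n

∑-*ˡ : ∀ c (f : Vector ℕ n) → ∑[ x < n ] (c * f x) ≡ c * sum f
∑-*ˡ c f = sym (*-distribˡ-sum c f)

∑-*ʳ : ∀ (f : Vector ℕ n) c → ∑[ x < n ] (f x * c) ≡ sum f * c
∑-*ʳ f c = sym (*-distribʳ-sum c f)

-- Let W be the total weight and A the weighted sum. If W f(x) > A wherever w(x) > 0, summing w(x)(A
-- + 1) ≤ w(x) f(x) W gives W (A + 1) ≤ A W, which is absurd for W > 0.
weighted-average : (w f : Vector ℕ n) → 0 < sum w →
  ∃[ x ] 0 < w x × sum w * f x ≤ ∑[ y < n ] (w y * f y)
weighted-average {n} w f 0<W with any? (λ x → (0 <? w x) ×-dec (sum w * f x ≤? ∑[ y < n ] (w y * f y)))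
... | yes found = found
... | no  none  = contradiction (≤-trans sum-bound (≤-reflexive (*-comm A (sum w)))) (<⇒≱ lt)
  where
  A = ∑[ y < n ] (w y * f y)
  bound : ∀ x → w x * suc A ≤ w x * f x * sum w
  bound x with 0 <? w x
  ... | no  0≮w rewrite n≤0⇒n≡0 (≮⇒≥ 0≮w) = z≤n
  ... | yes 0<w = ≤-trans (*-monoʳ-≤ (w x) (≰⇒> λ le → none (x , 0<w , le)))
                    (≤-reflexive (trans (cong (w x *_) (*-comm (sum w) (f x))) (sym (*-assoc (w x) (f x) (sum w)))))
  sum-bound : sum w * suc A ≤ A * sum w
  sum-bound = subst₂ _≤_ (∑-*ʳ w (suc A)) (∑-*ʳ (λ x → w x * f x) (sum w)) (∑-mono bound)
  lt : sum w * A < sum w * suc A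
  lt = *-monoʳ-< (sum w) {{>-nonZero 0<W}} (n<1+n A)

∣_∣≡∑ : (S : Subset n) → ∣ S ∣ ≡ ∑[ x < n ] ⟦ x ∈? S ⟧
∣ []          ∣≡∑ = refl
∣ inside  ∷ S ∣≡∑ = cong suc ∣ S ∣≡∑
∣ outside ∷ S ∣≡∑ = ∣ S ∣≡∑

-- Saturation in a projective plane

insert : Subset n → Fin n → Subset n
insert S x = S [ x ]≔ inside

∈-insert : (S : Subset n) (x : Fin n) → x ∈ insert S x
∈-insert S x = []≔-updates S x

insert-⊇ : (S : Subset n) (x : Fin n) {y : Fin n} → y ∈ S → y ∈ insert S x
insert-⊇ S x {y} y∈S with y ≟ᶠ x
... | yes refl = ∈-insert S x
... | no  y≢x  = []≔-minimal S y x y≢x y∈S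

insert⁻ : (S : Subset n) (x : Fin n) {y : Fin n} → y ∈ insert S x → y ≡ x ⊎ y ∈ S
insert⁻ (s ∷ S) zero    here        = inj₁ refl
insert⁻ (s ∷ S) zero    (there y∈)  = inj₂ (there y∈)
insert⁻ (s ∷ S) (suc x) here        = inj₂ here
insert⁻ (s ∷ S) (suc x) (there y∈) with insert⁻ S x y∈
... | inj₁ refl = inj₁ refl
... | inj₂ y∈S  = inj₂ (there y∈S)

∣insert∣ : (S : Subset n) {x : Fin n} → x ∉ S → ∣ insert S x ∣ ≡ suc ∣ S ∣
∣insert∣ (inside  ∷ S) {zero}  x∉S = contradiction here x∉S
∣insert∣ (outside ∷ S) {zero}  x∉S = refl
∣insert∣ (inside  ∷ S) {suc x} x∉S = cong suc (∣insert∣ S (x∉S ∘ there))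
∣insert∣ (outside ∷ S) {suc x} x∉S = ∣insert∣ S (x∉S ∘ there)

∣insert∣≤ : (S : Subset n) (x : Fin n) → ∣ insert S x ∣ ≤ suc ∣ S ∣
∣insert∣≤ (inside  ∷ S) zero    = n≤1+n _
∣insert∣≤ (outside ∷ S) zero    = ≤-refl
∣insert∣≤ (inside  ∷ S) (suc x) = s≤s (∣insert∣≤ S x)
∣insert∣≤ (outside ∷ S) (suc x) = ∣insert∣≤ S x

∣S∣+∣∁S∣ : (S : Subset n) → ∣ S ∣ + ∑[ x < n ] ⟦ ¬? (x ∈? S) ⟧ ≡ n
∣S∣+∣∁S∣ {n} S = begin
  ∣ S ∣ + ∑[ x < n ] ⟦ ¬? (x ∈? S) ⟧
    ≡⟨ cong (_+ ∑[ x < n ] ⟦ ¬? (x ∈? S) ⟧) ∣ S ∣≡∑ ⟩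
  ∑[ x < n ] ⟦ x ∈? S ⟧ + ∑[ x < n ] ⟦ ¬? (x ∈? S) ⟧
    ≡⟨ ∑-distrib-+ (λ x → ⟦ x ∈? S ⟧) (λ x → ⟦ ¬? (x ∈? S) ⟧) ⟨
  ∑[ x < n ] (⟦ x ∈? S ⟧ + ⟦ ¬? (x ∈? S) ⟧)
    ≡⟨ sum-cong-≗ (λ x → ⟦⟧+⟦¬⟧ (x ∈? S)) ⟩
  ∑[ x < n ] 1
    ≡⟨ trans (∑-const n 1) (*-identityʳ n) ⟩
  n ∎
  where open ≡-Reasoning

two-members : (S : Subset n) → 2 ≤ ∣ S ∣ → ∃₂ λ s t → s ∈ S × t ∈ S × s ≢ t
two-members S 2≤∣S∣ with any? (λ s → any? λ t → (s ∈? S) ×-dec (t ∈? S) ×-dec ¬? (s ≟ᶠ t))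
... | yes found = found
... | no  none  = contradiction
        (subst (_≤ 1) (sym ∣ S ∣≡∑) (∑-atMostOne _ (λ s → ⟦⟧≤1 (s ∈? S)) λ s t 0<s 0<t →
          decidable-stable (s ≟ᶠ t) λ s≢t → none (s , t , 0<⟦⟧⇒ (s ∈? S) 0<s , 0<⟦⟧⇒ (t ∈? S) 0<t , s≢t)))
        (<⇒≱ 2≤∣S∣)

module Plane (Π : ProjectivePlane) {q : ℕ} (order : HasOrder Π q) where
  open ProjectivePlane Π

  -- Incidence counts in a plane of order q

  on : Point → Line → ℕ
  on P l = ⟦ P ∈? pointsOn l ⟧

  collinear⇒same : ∀ {A B l m} → A ≢ B → A ∈ pointsOn l → B ∈ pointsOn l →
                   A ∈ pointsOn m → B ∈ pointsOn m → l ≡ m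
  collinear⇒same A≢B Al Bl Am Bm =
    let _ , _ , unique = join A≢B in trans (sym (unique (Al , Bl))) (unique (Am , Bm))

  -- No point is on all three sides of a triangle: two sides share only their common vertex, which
  -- is off the third.
  avoidingLine : ∀ P → ∃[ l ] P ∉ pointsOn l
  avoidingLine P with quadrangle
  ... | Q , Q-inj , Q-general = search
    where
    0F 1F 2F : Fin 4
    0F = zero
    1F = suc zero
    2F = suc (suc zero)
    side : ∀ {i j} → i ≢ j → Line
    side i≢j = proj₁ (join (i≢j ∘ Q-inj))
    onSide : ∀ {i j} (i≢j : i ≢ j) → Q i ∈ pointsOn (side i≢j) × Q j ∈ pointsOn (side i≢j)
    onSide i≢j = proj₁ (proj₂ (join (i≢j ∘ Q-inj)))
    0≢1 : 0F ≢ 1F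
    0≢1 ()
    0≢2 : 0F ≢ 2F
    0≢2 ()
    1≢2 : 1F ≢ 2F
    1≢2 ()
    search : ∃[ l ] P ∉ pointsOn l
    search with P ∈? pointsOn (side 0≢1) | P ∈? pointsOn (side 0≢2) | P ∈? pointsOn (side 1≢2)
    ... | no P∉ | _      | _     = side 0≢1 , P∉
    ... | yes _ | no P∉  | _     = side 0≢2 , P∉
    ... | yes _ | yes _  | no P∉ = side 1≢2 , P∉
    ... | yes P∈01 | yes P∈02 | yes P∈12 with P ≟ᶠ Q 0F
    ...   | yes refl = ⊥-elim (Q-general (side 1≢2) 0≢1 1≢2 0≢2 (P∈12 , onSide 1≢2))
    ...   | no P≢Q0 = ⊥-elim (Q-general (side 0≢1) 0≢1 1≢2 0≢2
              (proj₁ (onSide 0≢1) , proj₂ (onSide 0≢1) ,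
               subst (λ l → Q 2F ∈ pointsOn l)
                 (collinear⇒same P≢Q0 P∈02 (proj₁ (onSide 0≢2)) P∈01 (proj₁ (onSide 0≢1)))
                 (proj₂ (onSide 0≢2))))

  ∑-on-line : ∀ l → ∑[ x < #points ] on x l ≡ suc q
  ∑-on-line l = trans (sym ∣ pointsOn l ∣≡∑) (order l)

  joins : Point → Point → ℕ
  joins A B = ∑[ l < #lines ] (on A l * on B l)

  joins≡1 : ∀ {A B} → A ≢ B → joins A B ≡ 1
  joins≡1 {A} {B} A≢B = trans
    (sum-cong-≗ λ l → ⟦⟧-× (A ∈? pointsOn l) (B ∈? pointsOn l))
    (∑-∃! (λ l → (A ∈? pointsOn l) ×-dec (B ∈? pointsOn l)) (join A≢B))

  meets≡1 : ∀ {l m} → l ≢ m → ∑[ x < #points ] (on x l * on x m) ≡ 1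
  meets≡1 {l} {m} l≢m = trans
    (sum-cong-≗ λ x → ⟦⟧-× (x ∈? pointsOn l) (x ∈? pointsOn m))
    (∑-∃! (λ x → (x ∈? pointsOn l) ×-dec (x ∈? pointsOn m)) (meet l≢m))

  on² : ∀ A l → on A l * on A l ≡ on A l
  on² A l with A ∈? pointsOn l
  ... | yes _ = refl
  ... | no _  = refl

  on-case : ∀ A l {f g : ℕ} → (A ∈ pointsOn l → f ≡ g) → on A l * f ≡ on A l * g
  on-case A l f≡g with A ∈? pointsOn l
  ... | yes A∈l = cong (1 *_) (f≡g A∈l)
  ... | no _    = refl

  -- Projecting from A onto a line m that avoids it matches the lines through A with the q + 1
  -- points of m; the matching is carried out as a double count.
  degree : ∀ A → ∑[ l < #lines ] on A l ≡ suc q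
  degree A = let m , A∉m = avoidingLine A in sym (begin
    suc q
      ≡⟨ ∑-on-line m ⟨
    ∑[ x < #points ] on x m
      ≡⟨ sum-cong-≗ (λ x → trans (sym (*-identityʳ (on x m)))
           (on-case x m λ x∈m → sym (joins≡1 {A} {x} λ { refl → A∉m x∈m }))) ⟩
    ∑[ x < #points ] (on x m * joins A x)
      ≡⟨ sum-cong-≗ (λ x → sym (∑-*ˡ (on x m) (λ l → on A l * on x l))) ⟩
    ∑[ x < #points ] ∑[ l < #lines ] (on x m * (on A l * on x l))
      ≡⟨ ∑-comm (λ x l → on x m * (on A l * on x l)) ⟩
    ∑[ l < #lines ] ∑[ x < #points ] (on x m * (on A l * on x l))
      ≡⟨ sum-cong-≗ (λ l → trans (sum-cong-≗ λ x → rearrange (on x m) (on A l) (on x l))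
           (∑-*ˡ (on A l) (λ x → on x l * on x m))) ⟩
    ∑[ l < #lines ] (on A l * ∑[ x < #points ] (on x l * on x m))
      ≡⟨ sum-cong-≗ (λ l → trans (on-case A l λ A∈l → meets≡1 λ { refl → A∉m A∈l })
           (*-identityʳ (on A l))) ⟩
    ∑[ l < #lines ] on A l ∎)
    where
    open ≡-Reasoning
    rearrange : ∀ a b c → a * (b * c) ≡ b * (c * a)
    rearrange = solve-∀

  joins-self : ∀ A → joins A A ≡ suc q
  joins-self A = trans (sum-cong-≗ (on² A)) (degree A)

  -- The q + 1 lines through A carry (q + 1)² incidences, in which A occurs q + 1 times and every
  -- other point once. The excess at A is added on the other side to avoid subtraction.
  #points≡ : #points ≡ suc (q + q * q)
  #points≡ = +-cancelʳ-≡ (suc q) _ _ (begin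
    #points + suc q
      ≡⟨ cong₂ _+_ (trans (sym (*-identityʳ #points)) (sym (∑-const #points 1)))
           (sym (∑-select A (λ _ → suc q))) ⟩
    ∑[ x < #points ] 1 + ∑[ x < #points ] (⟦ x ≟ᶠ A ⟧ * suc q)
      ≡⟨ ∑-distrib-+ (λ _ → 1) (λ x → ⟦ x ≟ᶠ A ⟧ * suc q) ⟨
    ∑[ x < #points ] (1 + ⟦ x ≟ᶠ A ⟧ * suc q)
      ≡⟨ sum-cong-≗ termwise ⟩
    ∑[ x < #points ] (joins A x + ⟦ x ≟ᶠ A ⟧)
      ≡⟨ ∑-distrib-+ (joins A) (λ x → ⟦ x ≟ᶠ A ⟧) ⟩
    ∑[ x < #points ] joins A x + ∑[ x < #points ] ⟦ x ≟ᶠ A ⟧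
      ≡⟨ cong₂ _+_ flags (∑-⟦≟⟧ A) ⟩
    suc q * suc q + 1
      ≡⟨ expand q ⟩
    suc (q + q * q) + suc q ∎)
    where
    open ≡-Reasoning
    A = proj₁ quadrangle zero
    expand : ∀ q → suc q * suc q + 1 ≡ suc (q + q * q) + suc q
    expand = solve-∀
    termwise : ∀ x → 1 + ⟦ x ≟ᶠ A ⟧ * suc q ≡ joins A x + ⟦ x ≟ᶠ A ⟧
    termwise x with x ≟ᶠ A
    ... | yes refl = trans (cong suc (+-identityʳ (suc q)))
                       (trans (+-comm 1 (suc q)) (cong (_+ 1) (sym (joins-self x))))
    ... | no x≢A   = cong (_+ 0) (sym (joins≡1 (x≢A ∘ sym)))
    flags : ∑[ x < #points ] joins A x ≡ suc q * suc q
    flags = begin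
      ∑[ x < #points ] joins A x
        ≡⟨ ∑-comm (λ x l → on A l * on x l) ⟩
      ∑[ l < #lines ] ∑[ x < #points ] (on A l * on x l)
        ≡⟨ sum-cong-≗ (λ l → trans (∑-*ˡ (on A l) (λ x → on x l)) (cong (on A l *_) (∑-on-line l))) ⟩
      ∑[ l < #lines ] (on A l * suc q)
        ≡⟨ ∑-*ʳ (on A) (suc q) ⟩
      (∑[ l < #lines ] on A l) * suc q
        ≡⟨ cong (_* suc q) (degree A) ⟩
      suc q * suc q ∎

  -- Covered points and the average gain of one insertion

  Covered : Subset #points → Point → Set
  Covered S P = ∃₂ λ A B → A ∈ S × B ∈ S × A ≢ B ×
    ∃ λ l → P ∈ pointsOn l × A ∈ pointsOn l × B ∈ pointsOn l

  covered? : ∀ S → Decidable (Covered S)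
  covered? S P = any? λ A → any? λ B → (A ∈? S) ×-dec (B ∈? S) ×-dec ¬? (A ≟ᶠ B) ×-dec
    any? λ l → (P ∈? pointsOn l) ×-dec (A ∈? pointsOn l) ×-dec (B ∈? pointsOn l)

  Uncovered : Subset #points → Point → Set
  Uncovered S P = P ∉ S × ¬ Covered S P

  -- Abstract, as with-abstractions over it would otherwise see it unfolded.
  abstract
    uncovered? : ∀ S → Decidable (Uncovered S)
    uncovered? S P = ¬? (P ∈? S) ×-dec ¬? (covered? S P)

  saturating? : Decidable (Saturating Π)
  saturating? S = all? λ P → ¬? (P ∈? S) →-dec covered? S P

  uncoveredCount : Subset #points → ℕ
  uncoveredCount S = ∑[ P < #points ] ⟦ uncovered? S P ⟧

  noneUncovered⇒saturating : ∀ S → (∀ P → ¬ Uncovered S P) → Saturating Π S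
  noneUncovered⇒saturating S none P P∉S =
    decidable-stable (covered? S P) λ ¬cov → none P (P∉S , ¬cov)

  uncovered-insert : ∀ S x {P} → Uncovered (insert S x) P → Uncovered S P
  uncovered-insert S x (P∉ , ¬cov) = (λ P∈S → P∉ (insert-⊇ S x P∈S)) ,
    λ { (A , B , A∈S , B∈S , rest) → ¬cov (A , B , insert-⊇ S x A∈S , insert-⊇ S x B∈S , rest) }

  trace : Subset #points → Line → ℕ
  trace S l = ∑[ s < #points ] (⟦ s ∈? S ⟧ * on s l)

  trace-member : ∀ S l s → 0 < ⟦ s ∈? S ⟧ * on s l → s ∈ S × s ∈ pointsOn l
  trace-member S l s 0<t with s ∈? S | s ∈? pointsOn l
  ... | yes s∈S | yes s∈l = s∈S , s∈l
  ... | yes _   | no _    = contradiction 0<t λ ()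
  ... | no _    | _       = contradiction 0<t λ ()

  trace≤1 : ∀ S {P l} → ¬ Covered S P → P ∈ pointsOn l → trace S l ≤ 1
  trace≤1 S {P} {l} ¬cov P∈l = ∑-atMostOne _
    (λ s → *-mono-≤ (⟦⟧≤1 (s ∈? S)) (⟦⟧≤1 (s ∈? pointsOn l)))
    λ s t 0<s 0<t → decidable-stable (s ≟ᶠ t) λ s≢t →
      let s∈S , s∈l = trace-member S l s 0<s ; t∈S , t∈l = trace-member S l t 0<t
      in ¬cov (s , t , s∈S , t∈S , s≢t , l , P∈l , s∈l , t∈l)

  -- For x ≢ P the number of points of S on the line Px; for x = P ∉ S it is ∣S∣. For uncovered P it
  -- thus marks the x ≢ P whose line to P meets S.
  secantsTo : Subset #points → Point → Point → ℕ
  secantsTo S P x = ∑[ l < #lines ] (on P l * on x l * trace S l)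

  -- As P ∉ S, each point of S is on exactly one line through P.
  ∑-trace-through : ∀ S {P} → P ∉ S → ∑[ l < #lines ] (on P l * trace S l) ≡ ∣ S ∣
  ∑-trace-through S {P} P∉S = begin
    ∑[ l < #lines ] (on P l * trace S l)
      ≡⟨ sum-cong-≗ (λ l → sym (∑-*ˡ (on P l) (λ s → ⟦ s ∈? S ⟧ * on s l))) ⟩
    ∑[ l < #lines ] ∑[ s < #points ] (on P l * (⟦ s ∈? S ⟧ * on s l))
      ≡⟨ ∑-comm (λ l s → on P l * (⟦ s ∈? S ⟧ * on s l)) ⟩
    ∑[ s < #points ] ∑[ l < #lines ] (on P l * (⟦ s ∈? S ⟧ * on s l))
      ≡⟨ sum-cong-≗ (λ s → trans (sum-cong-≗ λ l → swap (on P l) ⟦ s ∈? S ⟧ (on s l))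
           (∑-*ˡ ⟦ s ∈? S ⟧ (λ l → on P l * on s l))) ⟩
    ∑[ s < #points ] (⟦ s ∈? S ⟧ * joins P s)
      ≡⟨ sum-cong-≗ single ⟩
    ∑[ s < #points ] ⟦ s ∈? S ⟧
      ≡⟨ ∣ S ∣≡∑ ⟨
    ∣ S ∣ ∎
    where
    open ≡-Reasoning
    swap : ∀ a b c → a * (b * c) ≡ b * (a * c)
    swap = solve-∀
    single : ∀ s → ⟦ s ∈? S ⟧ * joins P s ≡ ⟦ s ∈? S ⟧
    single s with s ∈? S
    ... | yes s∈S = trans (+-identityʳ _) (joins≡1 {P} {s} λ { refl → P∉S s∈S })
    ... | no _    = refl

  secantsTo-self : ∀ S {P} → P ∉ S → secantsTo S P P ≡ ∣ S ∣
  secantsTo-self S {P} P∉S =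
    trans (sum-cong-≗ λ l → cong (_* trace S l) (on² P l)) (∑-trace-through S P∉S)

  ∑-secantsTo : ∀ S {P} → P ∉ S → ∑[ x < #points ] secantsTo S P x ≡ suc q * ∣ S ∣
  ∑-secantsTo S {P} P∉S = begin
    ∑[ x < #points ] ∑[ l < #lines ] (on P l * on x l * trace S l)
      ≡⟨ ∑-comm (λ x l → on P l * on x l * trace S l) ⟩
    ∑[ l < #lines ] ∑[ x < #points ] (on P l * on x l * trace S l)
      ≡⟨ sum-cong-≗ (λ l → trans (sum-cong-≗ λ x → rotate (on P l) (on x l) (trace S l))
           (trans (∑-*ʳ (λ x → on x l) (on P l * trace S l)) (cong (_* (on P l * trace S l)) (∑-on-line l)))) ⟩
    ∑[ l < #lines ] (suc q * (on P l * trace S l))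
      ≡⟨ ∑-*ˡ (suc q) (λ l → on P l * trace S l) ⟩
    suc q * ∑[ l < #lines ] (on P l * trace S l)
      ≡⟨ cong (suc q *_) (∑-trace-through S P∉S) ⟩
    suc q * ∣ S ∣ ∎
    where
    open ≡-Reasoning
    rotate : ∀ a b c → a * b * c ≡ b * (a * c)
    rotate = solve-∀

  secantsTo≤1 : ∀ S {P x} → ¬ Covered S P → P ≢ x → secantsTo S P x ≤ 1
  secantsTo≤1 S {P} {x} ¬cov P≢x = ≤-trans (∑-mono bound) (≤-reflexive (joins≡1 P≢x))
    where
    bound : ∀ l → on P l * on x l * trace S l ≤ on P l * on x l
    bound l with P ∈? pointsOn l
    ... | no _    = z≤n
    ... | yes P∈l = ≤-trans (*-monoʳ-≤ (1 * on x l) (trace≤1 S ¬cov P∈l)) (≤-reflexive (*-identityʳ _))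

  covered-insert : ∀ S {P x} → x ∉ S → 0 < secantsTo S P x → Covered (insert S x) P
  covered-insert S {P} {x} x∉S 0<g with 0<∑⇒∃ _ 0<g
  ... | l , 0<gl with P ∈? pointsOn l | x ∈? pointsOn l
  ... | no _    | _      = contradiction 0<gl λ ()
  ... | yes _   | no _   = contradiction 0<gl λ ()
  ... | yes P∈l | yes x∈l with 0<∑⇒∃ _ (subst (0 <_) (+-identityʳ (trace S l)) 0<gl)
  ... | s , 0<s with trace-member S l s 0<s
  ... | s∈S , s∈l = x , s , ∈-insert S x , insert-⊇ S x s∈S , (λ { refl → x∉S s∈S }) ,
                    l , P∈l , x∈l , s∈l

  -- If x ≢ P and the line Px meets S, then x is in S or its insertion covers P; so the first two
  -- terms are never both 1. At x = P the secant count is ∣S∣, which the terms in ⟦ x ≟ᶠ P ⟧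
  -- balance.
  extension-balance : ∀ S {P} → Uncovered S P → ∀ x →
    ⟦ ¬? (x ∈? S) ⟧ * ⟦ uncovered? (insert S x) P ⟧ + (secantsTo S P x + ⟦ x ≟ᶠ P ⟧) ≤
    1 + ⟦ x ≟ᶠ P ⟧ * ∣ S ∣
  extension-balance S {P} (P∉S , ¬cov) x with x ≟ᶠ P
  ... | yes refl = ≤-reflexive (trans
          (cong₂ (λ a b → ⟦ ¬? (x ∈? S) ⟧ * a + (b + 1))
            (⟦⟧-no (uncovered? (insert S x) x) (λ u → proj₁ u (∈-insert S x)))
            (secantsTo-self S P∉S))
          (tidy ⟦ ¬? (x ∈? S) ⟧ ∣ S ∣))
    where
    tidy : ∀ a s → a * 0 + (s + 1) ≡ 1 + (s + 0)
    tidy = solve-∀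
  ... | no x≢P with x ∈? S
  ...   | yes x∈S = ≤-trans (≤-reflexive (+-identityʳ _)) (secantsTo≤1 S ¬cov (x≢P ∘ sym))
  ...   | no x∉S with 0 <? secantsTo S P x
  ...     | no 0≮g rewrite n≤0⇒n≡0 (≮⇒≥ 0≮g) =
              subst (_≤ 1) (sym (trans (+-identityʳ _) (+-identityʳ _))) (⟦⟧≤1 (uncovered? (insert S x) P))
  ...     | yes 0<g rewrite ⟦⟧-no (uncovered? (insert S x) P) (λ u → proj₂ u (covered-insert S x∉S 0<g)) =
              ≤-trans (≤-reflexive (+-identityʳ _)) (secantsTo≤1 S ¬cov (x≢P ∘ sym))

  -- Summing `extension-balance` over all x counts (q + 1) ∣S∣ secant incidences, of which ∣S∣
  -- belong to x = P.
  ∑-extensions-uncovered : ∀ S {P} → Uncovered S P →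
    ∑[ x < #points ] (⟦ ¬? (x ∈? S) ⟧ * ⟦ uncovered? (insert S x) P ⟧) + q * ∣ S ∣ ≤ q + q * q
  ∑-extensions-uncovered S {P} unc = +-cancelʳ-≤ (∣ S ∣ + 1) _ _ (begin
    ∑w + q * ∣ S ∣ + (∣ S ∣ + 1)
      ≡⟨ tidy ∑w q ∣ S ∣ ⟩
    ∑w + (suc q * ∣ S ∣ + 1)
      ≡⟨ cong (_+_ ∑w) (trans (cong₂ _+_ (sym (∑-secantsTo S (proj₁ unc))) (sym (∑-⟦≟⟧ P)))
           (sym (∑-distrib-+ (secantsTo S P) (λ x → ⟦ x ≟ᶠ P ⟧)))) ⟩
    ∑w + ∑[ x < #points ] (secantsTo S P x + ⟦ x ≟ᶠ P ⟧)
      ≡⟨ ∑-distrib-+ w (λ x → secantsTo S P x + ⟦ x ≟ᶠ P ⟧) ⟨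
    ∑[ x < #points ] (w x + (secantsTo S P x + ⟦ x ≟ᶠ P ⟧))
      ≤⟨ ∑-mono (extension-balance S unc) ⟩
    ∑[ x < #points ] (1 + ⟦ x ≟ᶠ P ⟧ * ∣ S ∣)
      ≡⟨ ∑-distrib-+ (λ _ → 1) (λ x → ⟦ x ≟ᶠ P ⟧ * ∣ S ∣) ⟩
    ∑[ x < #points ] 1 + ∑[ x < #points ] (⟦ x ≟ᶠ P ⟧ * ∣ S ∣)
      ≡⟨ cong₂ _+_ (trans (∑-const #points 1) (trans (*-identityʳ #points) #points≡)) (∑-select P (λ _ → ∣ S ∣)) ⟩
    suc (q + q * q) + ∣ S ∣
      ≡⟨ trans (sym (+-suc (q + q * q) ∣ S ∣)) (cong (_+_ (q + q * q)) (+-comm 1 ∣ S ∣)) ⟩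
    q + q * q + (∣ S ∣ + 1) ∎)
    where
    open ≤-Reasoning
    w : Point → ℕ
    w x = ⟦ ¬? (x ∈? S) ⟧ * ⟦ uncovered? (insert S x) P ⟧
    ∑w = sum w
    tidy : ∀ a q s → a + q * s + (s + 1) ≡ a + (suc q * s + 1)
    tidy = solve-∀

  -- After exchanging the sums, each uncovered P contributes the choices of x that leave it
  -- uncovered. All other points contribute 0, as insertion uncovers nothing.
  ∑-extensions : ∀ S →
    ∑[ x < #points ] (⟦ ¬? (x ∈? S) ⟧ * uncoveredCount (insert S x)) + uncoveredCount S * (q * ∣ S ∣) ≤
    uncoveredCount S * (q + q * q)
  ∑-extensions S = begin
    ∑[ x < #points ] (⟦ ¬? (x ∈? S) ⟧ * uncoveredCount (insert S x)) + uncoveredCount S * (q * ∣ S ∣)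
      ≡⟨ cong₂ _+_
           (trans (sum-cong-≗ λ x → sym (∑-*ˡ ⟦ ¬? (x ∈? S) ⟧ (λ P → ⟦ uncovered? (insert S x) P ⟧)))
                  (∑-comm λ x P → ⟦ ¬? (x ∈? S) ⟧ * ⟦ uncovered? (insert S x) P ⟧))
           (sym (∑-*ʳ (λ P → ⟦ uncovered? S P ⟧) (q * ∣ S ∣))) ⟩
    sum left + ∑[ P < #points ] (⟦ uncovered? S P ⟧ * (q * ∣ S ∣))
      ≡⟨ ∑-distrib-+ left (λ P → ⟦ uncovered? S P ⟧ * (q * ∣ S ∣)) ⟨
    ∑[ P < #points ] (left P + ⟦ uncovered? S P ⟧ * (q * ∣ S ∣))
      ≤⟨ ∑-mono pointwise ⟩
    ∑[ P < #points ] (⟦ uncovered? S P ⟧ * (q + q * q))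
      ≡⟨ ∑-*ʳ (λ P → ⟦ uncovered? S P ⟧) (q + q * q) ⟩
    uncoveredCount S * (q + q * q) ∎
    where
    open ≤-Reasoning
    left : Point → ℕ
    left P = ∑[ x < #points ] (⟦ ¬? (x ∈? S) ⟧ * ⟦ uncovered? (insert S x) P ⟧)
    pointwise : ∀ P → left P + ⟦ uncovered? S P ⟧ * (q * ∣ S ∣) ≤ ⟦ uncovered? S P ⟧ * (q + q * q)
    pointwise P with uncovered? S P
    ... | yes unc = subst₂ _≤_ (cong (_+_ (left P)) (sym (+-identityʳ _))) (sym (+-identityʳ _))
                      (∑-extensions-uncovered S unc)
    ... | no ¬unc = ≤-reflexive (trans (+-identityʳ _) (trans (sum-cong-≗ λ x →
            trans (cong (⟦ ¬? (x ∈? S) ⟧ *_) (⟦⟧-no (uncovered? (insert S x) P) (¬unc ∘ uncovered-insert S x)))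
                  (*-zeroʳ ⟦ ¬? (x ∈? S) ⟧)) (trans (∑-const #points 0) (*-zeroʳ #points))))

  -- The average is over the c + 1 points outside S. The term with q ∣S∣ stays on the left in place
  -- of a truncated subtraction.
  greedy-step : ∀ S {c} → ∣ S ∣ + suc c ≡ #points → ∃[ T ] ∣ T ∣ ≡ suc ∣ S ∣ ×
    suc c * uncoveredCount T + uncoveredCount S * (q * ∣ S ∣) ≤ uncoveredCount S * (q + q * q)
  greedy-step S {c} ∣S∣+c =
    let W≡ = +-cancelˡ-≡ ∣ S ∣ _ _ (trans (∣S∣+∣∁S∣ S) (sym ∣S∣+c))
        x , 0<wx , avg = weighted-average (λ x → ⟦ ¬? (x ∈? S) ⟧) (λ x → uncoveredCount (insert S x))
                           (subst (0 <_) (sym W≡) z<s)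
    in insert S x , ∣insert∣ S (0<⟦⟧⇒ (¬? (x ∈? S)) 0<wx) ,
       ≤-trans (+-monoˡ-≤ (uncoveredCount S * (q * ∣ S ∣))
         (subst (λ W → W * uncoveredCount (insert S x) ≤
                       ∑[ y < #points ] (⟦ ¬? (y ∈? S) ⟧ * uncoveredCount (insert S y))) W≡ avg))
         (∑-extensions S)

  -- Covering the remaining points in pairs

  drop-two : ∀ S x {A B} → Uncovered S A → Uncovered S B → A ≢ B →
    ¬ Uncovered (insert S x) A → ¬ Uncovered (insert S x) B →
    2 + uncoveredCount (insert S x) ≤ uncoveredCount S
  drop-two S x {A} {B} uA uB A≢B ¬uA ¬uB = begin
    2 + uncoveredCount (insert S x)
      ≡⟨ cong (_+ uncoveredCount (insert S x)) (trans (cong₂ _+_ (sym (∑-⟦≟⟧ A)) (sym (∑-⟦≟⟧ B)))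
           (sym (∑-distrib-+ (λ P → ⟦ P ≟ᶠ A ⟧) (λ P → ⟦ P ≟ᶠ B ⟧)))) ⟩
    ∑[ P < #points ] (⟦ P ≟ᶠ A ⟧ + ⟦ P ≟ᶠ B ⟧) + uncoveredCount (insert S x)
      ≡⟨ ∑-distrib-+ (λ P → ⟦ P ≟ᶠ A ⟧ + ⟦ P ≟ᶠ B ⟧) (λ P → ⟦ uncovered? (insert S x) P ⟧) ⟨
    ∑[ P < #points ] (⟦ P ≟ᶠ A ⟧ + ⟦ P ≟ᶠ B ⟧ + ⟦ uncovered? (insert S x) P ⟧)
      ≤⟨ ∑-mono pointwise ⟩
    uncoveredCount S ∎
    where
    open ≤-Reasoning
    pointwise : ∀ P → ⟦ P ≟ᶠ A ⟧ + ⟦ P ≟ᶠ B ⟧ + ⟦ uncovered? (insert S x) P ⟧ ≤ ⟦ uncovered? S P ⟧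
    pointwise P with P ≟ᶠ A | P ≟ᶠ B
    ... | yes refl | yes refl = contradiction refl A≢B
    ... | yes refl | no _  rewrite ⟦⟧-no (uncovered? (insert S x) P) ¬uA | ⟦⟧-yes (uncovered? S P) uA = ≤-refl
    ... | no _ | yes refl  rewrite ⟦⟧-no (uncovered? (insert S x) P) ¬uB | ⟦⟧-yes (uncovered? S P) uB = ≤-refl
    ... | no _ | no _ = ⟦⟧-mono (uncovered? (insert S x) P) (uncovered? S P) (uncovered-insert S x)

  -- If B is on the line As, inserting A serves. Otherwise As and Bt meet in the point x to insert:
  -- x = s would put s and t on a line with B, which is uncovered, and x = t fails likewise.
  cover-two : ∀ S {s t A B} → s ∈ S → t ∈ S → s ≢ t → Uncovered S A → Uncovered S B → A ≢ B →
    ∃[ x ] ¬ Uncovered (insert S x) A × ¬ Uncovered (insert S x) B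
  cover-two S {s} {t} {A} {B} s∈S t∈S s≢t (A∉S , ¬cA) (B∉S , ¬cB) A≢B
    with join {A} {s} (λ { refl → A∉S s∈S }) | join {B} {t} (λ { refl → B∉S t∈S })
  ... | l , (A∈l , s∈l) , _ | m , (B∈m , t∈m) , _ with B ∈? pointsOn l
  ...   | yes B∈l = A , (λ u → proj₁ u (∈-insert S A)) ,
            (λ u → proj₂ u (A , s , ∈-insert S A , insert-⊇ S A s∈S , (λ { refl → A∉S s∈S }) ,
                            l , B∈l , A∈l , s∈l))
  ...   | no B∉l with meet {l} {m} (λ { refl → B∉l B∈m })
  ...     | x , (x∈l , x∈m) , _ = x ,
            (λ u → proj₂ u (x , s , ∈-insert S x , insert-⊇ S x s∈S ,
              (λ { refl → ¬cB (x , t , s∈S , t∈S , s≢t , m , B∈m , x∈m , t∈m) }) , l , A∈l , x∈l , s∈l)) ,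
            (λ u → proj₂ u (x , t , ∈-insert S x , insert-⊇ S x t∈S ,
              (λ { refl → ¬cA (s , x , s∈S , t∈S , s≢t , l , A∈l , s∈l , x∈l) }) , m , B∈m , x∈m , t∈m))

  noUncovered : ∀ S → uncoveredCount S ≡ 0 → Saturating Π S
  noUncovered S R≡0 = noneUncovered⇒saturating S λ P unc →
    contradiction (≤-trans (≤-reflexive (sym (⟦⟧-yes (uncovered? S P) unc))) (term≤∑ _ P))
      (<⇒≱ (subst (_< 1) (sym R≡0) z<s))

  -- Each insertion settles two uncovered points; a last single one is inserted itself. The members
  -- s and t serve in every round.
  complete-by-pairs : ∀ b S {s t} → s ∈ S → t ∈ S → s ≢ t → uncoveredCount S ≤ 2 * b →
    ∃[ T ] Saturating Π T × ∣ T ∣ ≤ ∣ S ∣ + b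
  complete-by-pairs b S {s} {t} s∈S t∈S s≢t R≤2b with any? (uncovered? S)
  ... | no none = S , noneUncovered⇒saturating S (λ P unc → none (P , unc)) , m≤m+n ∣ S ∣ b
  complete-by-pairs zero S s∈S t∈S s≢t R≤0 | yes _ = S , noUncovered S (n≤0⇒n≡0 R≤0) , m≤m+n ∣ S ∣ 0
  complete-by-pairs (suc b) S s∈S t∈S s≢t R≤2b | yes (A , uA)
    with any? (λ B → uncovered? S B ×-dec ¬? (A ≟ᶠ B))
  ... | no none = insert S A ,
          noneUncovered⇒saturating (insert S A) (λ P unc → none (P , uncovered-insert S A unc ,
            λ { refl → proj₁ unc (∈-insert S A) })) ,
          ≤-trans (∣insert∣≤ S A) (≤-trans (s≤s (m≤m+n ∣ S ∣ b)) (≤-reflexive (sym (+-suc ∣ S ∣ b))))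
  ... | yes (B , uB , A≢B) =
    let x , ¬uA , ¬uB = cover-two S s∈S t∈S s≢t uA uB A≢B
        T , sat , ∣T∣≤ = complete-by-pairs b (insert S x) (insert-⊇ S x s∈S) (insert-⊇ S x t∈S) s≢t
          (+-cancelˡ-≤ 2 _ _ (≤-trans (drop-two S x uA uB A≢B ¬uA ¬uB)
            (subst (uncoveredCount S ≤_) (*-distribˡ-+ 2 1 b) R≤2b)))
    in T , sat , ≤-trans ∣T∣≤ (≤-trans (+-monoˡ-≤ b (∣insert∣≤ S x)) (≤-reflexive (sym (+-suc ∣ S ∣ b))))

  -- The greedy construction

  greedy-pair : ∀ {a} → suc a ≡ q → ∃[ S ] ∣ S ∣ ≡ 2 × uncoveredCount S ≤ q * q
  greedy-pair {a} refl =
    -- From the empty set, the first two insertions lower the bound on the uncovered count from q² +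
    -- q + 1 to q² + q and then to q².
    let S₁ , ∣S₁∣ , R₁ = greedy-step ⊥ {q + q * q}
          (trans (cong (_+ suc (q + q * q)) (∣⊥∣≡0 #points)) (sym #points≡))
        ∣S₁∣≡1 = trans ∣S₁∣ (cong suc (∣⊥∣≡0 #points))
        S₂ , ∣S₂∣ , R₂ = greedy-step S₁ {a + q * q} (trans (cong (_+ (q + q * q)) ∣S₁∣≡1) (sym #points≡))
        R₁≤ = *-cancelˡ-≤ {uncoveredCount S₁} {q + q * q} (suc (q + q * q)) (begin
          suc (q + q * q) * uncoveredCount S₁      ≤⟨ m+n≤o⇒m≤o _ R₁ ⟩
          uncoveredCount ⊥ * (q + q * q)           ≤⟨ *-monoˡ-≤ (q + q * q) (uncoveredCount≤#points ⊥) ⟩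
          suc (q + q * q) * (q + q * q)            ∎)
        R₂≤ = *-cancelˡ-≤ {uncoveredCount S₂} {q * q} (q + q * q) (+-cancelʳ-≤ (uncoveredCount S₁ * q) _ _ (begin
          (q + q * q) * uncoveredCount S₂ + uncoveredCount S₁ * q
            ≡⟨ cong (λ z → (q + q * q) * uncoveredCount S₂ + uncoveredCount S₁ * z)
                 (sym (trans (cong (q *_) ∣S₁∣≡1) (*-identityʳ q))) ⟩
          (q + q * q) * uncoveredCount S₂ + uncoveredCount S₁ * (q * ∣ S₁ ∣)
            ≤⟨ R₂ ⟩
          uncoveredCount S₁ * (q + q * q)
            ≡⟨ expand (uncoveredCount S₁) q ⟩
          uncoveredCount S₁ * (q * q) + uncoveredCount S₁ * q
            ≤⟨ +-monoˡ-≤ _ (*-monoˡ-≤ (q * q) R₁≤) ⟩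
          (q + q * q) * (q * q) + uncoveredCount S₁ * q ∎))
    in S₂ , trans ∣S₂∣ (cong suc ∣S₁∣≡1) , R₂≤
    where
    open ≤-Reasoning
    expand : ∀ R q → R * (q + q * q) ≡ R * (q * q) + R * q
    expand = solve-∀
    uncoveredCount≤#points : ∀ S → uncoveredCount S ≤ suc (q + q * q)
    uncoveredCount≤#points S = ≤-trans (∑-mono λ P → ⟦⟧≤1 (uncovered? S P))
      (≤-reflexive (trans (∑-const #points 1) (trans (*-identityʳ #points) #points≡)))

  -- With ∣S∣ = 2 + i and a = q - 1 - i, exactly q² + a points are outside S, and q + q² - q ∣S∣ = q
  -- a.
  greedy-step′ : ∀ S i a c → ∣ S ∣ ≡ 2 + i → a + suc i ≡ q → suc c ≡ q * q + a → ∃[ T ] ∣ T ∣ ≡ 3 + i ×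
    (q * q + a) * uncoveredCount T ≤ uncoveredCount S * (q * a)
  greedy-step′ S i a c ∣S∣ a+i≡q c≡ =
    let T , ∣T∣ , R≤ = greedy-step S {c} (trans (cong₂ _+_ ∣S∣ c≡) (trans remaining (sym #points≡)))
    in T , trans ∣T∣ (cong suc ∣S∣) ,
       +-cancelʳ-≤ (uncoveredCount S * (q * (2 + i))) _ _ (subst₂ _≤_
         (cong₂ (λ c s → c * uncoveredCount T + uncoveredCount S * (q * s)) c≡ ∣S∣)
         (trans (cong (λ z → uncoveredCount S * (q + q * z)) (sym a+i≡q)) (split (uncoveredCount S) q a i)) R≤)
    where
    remaining : 2 + i + (q * q + a) ≡ suc (q + q * q)
    remaining = trans (regroup i (q * q) a) (cong (λ z → suc (z + q * q)) a+i≡q)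
      where
      regroup : ∀ i b a → 2 + i + (b + a) ≡ suc (a + suc i + b)
      regroup = solve-∀
    split : ∀ R q a i → R * (q + q * (a + suc i)) ≡ R * (q * a) + R * (q * (2 + i))
    split = solve-∀

  -- The factors q (a + j)/(q² + a + j) for 1 ≤ j ≤ i, cleared of denominators. Later insertions
  -- bring the smaller j, so the induction recurses on i with a raised by 1.
  greedy : ∀ i a → a + suc i ≡ q → ∃[ S ] ∣ S ∣ ≡ 2 + i ×
    uncoveredCount S * rising (q * q + a) i ≤ q ^ (2 + i) * rising a i
  greedy zero a a+1≡q =
    let S , ∣S∣≡2 , R≤ = greedy-pair (trans (+-comm 1 a) a+1≡q)
    in S , ∣S∣≡2 , *-monoˡ-≤ 1 (subst (uncoveredCount S ≤_) (cong (q *_) (sym (*-identityʳ q))) R≤)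
  greedy (suc i) a a+i≡q =
    let a+i≡q′ = trans (sym (+-suc a (suc i))) a+i≡q
        S , ∣S∣ , bound = greedy i (suc a) a+i≡q′
        T , ∣T∣ , step  = greedy-step′ S i (suc a) (q * q + a) ∣S∣ a+i≡q′ (sym (+-suc (q * q) a))
        open ≤-Reasoning
    in T , ∣T∣ , (begin
      uncoveredCount T * (suc (q * q + a) * rising (suc (q * q + a)) i)
        ≡⟨ cong (λ z → uncoveredCount T * (z * rising z i)) (+-suc (q * q) a) ⟨
      uncoveredCount T * ((q * q + suc a) * rising (q * q + suc a) i)
        ≡⟨ eq₁ (uncoveredCount T) (q * q + suc a) (rising (q * q + suc a) i) ⟩
      (q * q + suc a) * uncoveredCount T * rising (q * q + suc a) i
        ≤⟨ *-monoˡ-≤ (rising (q * q + suc a) i) step ⟩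
      uncoveredCount S * (q * suc a) * rising (q * q + suc a) i
        ≡⟨ eq₂ (uncoveredCount S) (q * suc a) (rising (q * q + suc a) i) ⟩
      q * suc a * (uncoveredCount S * rising (q * q + suc a) i)
        ≤⟨ *-monoʳ-≤ (q * suc a) bound ⟩
      q * suc a * (q ^ (2 + i) * rising (suc a) i)
        ≡⟨ eq₃ q (suc a) (q ^ (2 + i)) (rising (suc a) i) ⟩
      q * q ^ (2 + i) * (suc a * rising (suc a) i) ∎)
    where
    eq₁ : ∀ a b c → a * (b * c) ≡ b * a * c
    eq₁ = solve-∀
    eq₂ : ∀ a b c → a * b * c ≡ b * (a * c)
    eq₂ = solve-∀
    eq₃ : ∀ a b c d → a * b * (c * d) ≡ a * c * (b * d)
    eq₃ = solve-∀

  -- Once ∣S∣ = q + 1 the factor a is 0, and the next insertion leaves nothing uncovered.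
  greedy-saturating : 0 < q → ∃[ T ] Saturating Π T × ∣ T ∣ ≡ 2 + q
  greedy-saturating 0<q =
    let i = pred q
        suc-i = suc-pred q {{>-nonZero 0<q}}
        S , ∣S∣ , _  = greedy i 0 suc-i
        c≡ = suc-pred (q * q + 0) {{>-nonZero 0<q²}}
        T , ∣T∣ , le = greedy-step′ S i 0 (pred (q * q + 0)) ∣S∣ suc-i c≡
    in T , noUncovered T (n≤0⇒n≡0 (*-cancelˡ-≤ (q * q + 0) {{>-nonZero 0<q²}}
             (subst₂ _≤_ refl (trans (cong (uncoveredCount S *_) (*-zeroʳ q))
               (trans (*-zeroʳ (uncoveredCount S)) (sym (*-zeroʳ (q * q + 0))))) le))) ,
       trans ∣T∣ (cong (_+_ 2) suc-i)
    where
    0<q² : 0 < q * q + 0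
    0<q² = subst (0 <_) (sym (+-identityʳ (q * q))) (*-mono-≤ 0<q 0<q)

  -- The bound and the existence of a minimum

  small-saturating : ∀ {k} c → 2 ≤ q → k ²≥ 3 * q ln q → q ≤ suc (2 * c) * suc (2 * c) →
    ∃[ T ] Saturating Π T × ∣ T ∣ ≤ k + suc c
  small-saturating {k} c 2≤q bound q≤odd² with k ≤? q
  ... | no k≰q =
    let T , sat , ∣T∣≡ = greedy-saturating (≤-trans (s≤s z≤n) 2≤q)
    in T , sat , (begin
      ∣ T ∣          ≡⟨ ∣T∣≡ ⟩
      2 + q          ≤⟨ s≤s (≰⇒> k≰q) ⟩
      suc k          ≤⟨ s≤s (m≤m+n k c) ⟩
      suc (k + c)    ≡⟨ +-suc k c ⟨
      k + suc c      ∎)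
    where open ≤-Reasoning
  ... | yes k≤q with gap-applies q k 2≤q k≤q bound
  ...   | m , n , q≡ , refl , g =
    -- The greedy part stops at 4 + n = k + 1 points, which leaves c insertions for at most 2c
    -- uncovered points.
    let S , ∣S∣ , R≤ = greedy (2 + n) m (sym q≡)
        s , t , s∈S , t∈S , s≢t = two-members S (subst (2 ≤_) (sym ∣S∣) (s≤s (s≤s z≤n)))
        R²<odd² = <-≤-trans (greedy-count<√q m n q≡ g bound (uncoveredCount S) R≤) q≤odd²
        R≤2c = ≮⇒≥ λ 2c<R → <⇒≱ R²<odd² (*-mono-≤ 2c<R 2c<R)
        T , sat , ∣T∣≤ = complete-by-pairs c S s∈S t∈S s≢t R≤2c
    in T , sat , ≤-trans ∣T∣≤ (≤-reflexive (trans (cong (_+ c) ∣S∣) (sym (+-suc (3 + n) c))))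

  -- Saturation is decidable and subsets can be searched, so b is lowered until no saturating set of
  -- smaller size is left.
  minimal-saturating : ∀ b S → Saturating Π S → ∣ S ∣ ≤ b → ∃ (IsMinSaturatingSize Π)
  minimal-saturating zero    S sat ∣S∣≤ = 0 , (S , sat , n≤0⇒n≡0 ∣S∣≤) , λ _ _ → z≤n
  minimal-saturating (suc b) S sat ∣S∣≤ with anySubset? (λ T → saturating? T ×-dec (∣ T ∣ ≤? b))
  ... | yes (T , satT , ∣T∣≤) = minimal-saturating b T satT ∣T∣≤
  ... | no none = suc b , (S , sat , ≤-antisym ∣S∣≤ (smallest S sat)) , smallest
    where
    smallest : ∀ T → Saturating Π T → suc b ≤ ∣ T ∣
    smallest T satT = ≰⇒> λ ∣T∣≤ → none (T , satT , ∣T∣≤)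

mainTheorem2 : ∀ (q : ℕ) → 2 ≤ q →
    ∀ (Π : ProjectivePlane) → HasOrder Π q →
    ∃[ m ] IsMinSaturatingSize Π m ×
    (∀ (a b : ℤ) →
    IsCeiling (√ ((3 * q) · ln q)) a →
    IsCeiling ((√ (fromℕ q) ⊕ fromℕ 1) /2) b →
    (+ m) ℤ.≤ (a ℤ.+ b))
mainTheorem2 q 2≤q Π order =
  let 0<q = ≤-trans (s≤s z≤n) 2≤q
      -- Some saturating set is needed to start the search for the minimum; its size is immaterial.
      T₀ , sat₀ , _ = greedy-saturating 0<q
      m , isMin = minimal-saturating ∣ T₀ ∣ T₀ sat₀ ≤-refl
  in m , isMin , λ a b ceil-a ceil-b → bounded m isMin 0<q (ceiling-√-ln ceil-a) (ceiling-half-√ 0<q ceil-b)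
  where
  open Plane Π order
  bounded : ∀ m → IsMinSaturatingSize Π m → 0 < q → ∀ {a b} →
    ∃[ k ] a ≡ + k × k ²≥ 3 * q ln q →
    ∃[ c ] b ≡ + suc c × q ≤ suc (2 * c) * suc (2 * c) →
    (+ m) ℤ.≤ (a ℤ.+ b)
  bounded m (_ , least) 0<q (k , refl , bound) (c , refl , q≤odd²) =
    let T , sat , ∣T∣≤ = small-saturating c 2≤q bound q≤odd²
    in ℤ.+≤+ (≤-trans (least T sat) ∣T∣≤)
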